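{- For all $\epsilon>0$ and for all sufficiently large $n>n(\epsilon)$, there exists an $n$-vertex graph $G$ with slope parameter $$\mathsf{sl}(G)\geq\frac{n^2}{(4+\epsilon)\log n},$$ where $\log$ denotes the binary logarithm.
   Context: Graphs are undirected, finite and simple. For a set $P\subseteq\mathbb{R}^2$ of points in the plane and a set $S\subset\mathbb{R}\cup\{\infty\}$ of slopes, $G(P,S)$ is the graph with vertex set $P$ in which two distinct points $v,w\in P$ are adjacent if and only if the slope of the line $\overline{vw}$ is in $S$. The slope parameter $\mathsf{sl}(G)$ of a graph $G$ is the minimum integer $k$ such that $G\cong G(P,S)$ for some point set $P$ and slope set $S$ with $|S|=k$. -}

module Defs where

open import Data.Fin.Base using (Fin)
open import Data.Fin.Permutation using (Permutation; _⟨$⟩ʳ_)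
open import Data.Integer.Base as ℤ using (ℤ; +_)
import Data.Integer.Properties as ℤ
open import Data.Nat.Base as ℕ using (ℕ; zero; suc; z≤n; s≤s)
open import Data.Nat.Logarithm using (⌊log₂_⌋; ⌊log₂⌊n/2⌋⌋≡⌊log₂n⌋∸1; ⌊log₂⌋-mono-≤; ⌊log₂[2^n]⌋≡n)
import Data.Nat.Properties as ℕ
open import Data.Product.Base using (Σ; ∃; ∃-syntax; _×_; _,_; proj₁; proj₂)
open import Data.Rational.Base as ℚ using (ℚ; 0ℚ; 1ℚ; ½)
import Data.Rational.Properties as ℚ
open import Data.Rational.Solver using (module +-*-Solver)
open import Data.Rational.Unnormalised.Base as ℚᵘ using (mkℚᵘ)
import Data.Rational.Unnormalised.Properties as ℚᵘ
open import Data.Sum.Base using (inj₁; inj₂)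
open import Function.Bundles using (_⇔_)
open import Function.Definitions using (Injective)
open import Level using (0ℓ)
open import Relation.Binary.Core using (Rel)
open import Relation.Binary.Definitions using (Symmetric; Irreflexive)
open import Relation.Binary.PropositionalEquality
  using (_≡_; _≢_; refl; sym; trans; cong; cong₂; subst; subst₂; ≢-sym)
open import Relation.Nullary.Negation.Core using (¬_; contradiction)

------------------------------------------------------------------------
-- Real numbers

Cauchy : (ℕ → ℚ) → Set
Cauchy s = ∀ δ → 0ℚ ℚ.< δ →
  ∃[ N ] ∀ {m n} → N ℕ.≤ m → N ℕ.≤ n → ℚ.∣ s m ℚ.- s n ∣ ℚ.< δ

-- Cauchy sequences of rationals.  There are no quotient types, so the
-- equality of real numbers is the relation _≈_ below, never _≡_.
record ℝ : Set where
  constructor mkℝ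
  field
    seq    : ℕ → ℚ
    cauchy : Cauchy seq

open ℝ public

infix 4 _≈_ _<_ _≤_

_≈_ : Rel ℝ 0ℓ
x ≈ y = ∀ δ → 0ℚ ℚ.< δ →
  ∃[ N ] ∀ {n} → N ℕ.≤ n → ℚ.∣ seq x n ℚ.- seq y n ∣ ℚ.< δ

_<_ : Rel ℝ 0ℓ
x < y = ∃[ δ ] 0ℚ ℚ.< δ × ∃[ N ] ∀ {n} → N ℕ.≤ n → seq x n ℚ.+ δ ℚ.≤ seq y n

_≤_ : Rel ℝ 0ℓ
x ≤ y = ¬ (y < x)

private
  open ℚ.≤-Reasoning

  ∣p∣<q : ∀ {p q} → p ℚ.< q → ℚ.- p ℚ.< q → ℚ.∣ p ∣ ℚ.< q
  ∣p∣<q {p} p<q -p<q with ℚ.∣p∣≡p∨∣p∣≡-p p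
  ... | inj₁ eq = subst (ℚ._< _) (sym eq) p<q
  ... | inj₂ eq = subst (ℚ._< _) (sym eq) -p<q

  0≤∣p∣ : ∀ p → 0ℚ ℚ.≤ ℚ.∣ p ∣
  0≤∣p∣ p = ℚ.nonNegative⁻¹ ℚ.∣ p ∣ {{ℚ.∣-∣-nonNeg p}}

  0<½*p : ∀ {p} → 0ℚ ℚ.< p → 0ℚ ℚ.< ½ ℚ.* p
  0<½*p {p} 0<p =
    subst (ℚ._< ½ ℚ.* p) (ℚ.*-zeroʳ ½) (ℚ.*-monoʳ-<-pos ½ 0<p)

  ½p+½p : ∀ p → ½ ℚ.* p ℚ.+ ½ ℚ.* p ≡ p
  ½p+½p p = trans (sym (ℚ.*-distribʳ-+ p ½ ½)) (ℚ.*-identityˡ p)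

  sub-+ : ∀ a b c d → (a ℚ.+ b) ℚ.- (c ℚ.+ d) ≡ (a ℚ.- c) ℚ.+ (b ℚ.- d)
  sub-+ = solve 4 (λ a b c d → (a :+ b) :- (c :+ d) := (a :- c) :+ (b :- d)) refl
    where open +-*-Solver

  sub-neg : ∀ a b → ℚ.- a ℚ.- ℚ.- b ≡ ℚ.- (a ℚ.- b)
  sub-neg = solve 2 (λ a b → (:- a) :- (:- b) := :- (a :- b)) refl
    where open +-*-Solver

  sub-* : ∀ a b c d →
    a ℚ.* b ℚ.- c ℚ.* d ≡ a ℚ.* (b ℚ.- d) ℚ.+ d ℚ.* (a ℚ.- c)
  sub-* = solve 4 (λ a b c d →
    a :* b :- c :* d := a :* (b :- d) :+ d :* (a :- c)) refl
    where open +-*-Solver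

  -- An upper bound for the absolute values of a tail.
  bounded : ∀ {s} → Cauchy s →
    ∃[ B ] 0ℚ ℚ.< B × ∃[ N ] ∀ {n} → N ℕ.≤ n → ℚ.∣ s n ∣ ℚ.≤ B
  bounded {s} c with c 1ℚ (ℚ.positive⁻¹ 1ℚ)
  ... | N , close = ℚ.∣ s N ∣ ℚ.+ 1ℚ
      , ℚ.+-mono-≤-< (0≤∣p∣ (s N)) (ℚ.positive⁻¹ 1ℚ)
      , N , λ {n} N≤n → begin
        ℚ.∣ s n ∣                           ≡⟨ cong ℚ.∣_∣ (split (s n) (s N)) ⟩
        ℚ.∣ s N ℚ.+ (s n ℚ.- s N) ∣         ≤⟨ ℚ.∣p+q∣≤∣p∣+∣q∣ (s N) _ ⟩
        ℚ.∣ s N ∣ ℚ.+ ℚ.∣ s n ℚ.- s N ∣     ≤⟨ ℚ.+-monoʳ-≤ ℚ.∣ s N ∣ (ℚ.<⇒≤ (close N≤n ℕ.≤-refl)) ⟩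
        ℚ.∣ s N ∣ ℚ.+ 1ℚ                    ∎
    where
    open +-*-Solver
    split : ∀ a b → a ≡ b ℚ.+ (a ℚ.- b)
    split = solve 2 (λ a b → a := b :+ (a :- b)) refl

  ∣p*q∣<B*η : ∀ {p q B η} → 0ℚ ℚ.< B →
    ℚ.∣ p ∣ ℚ.≤ B → ℚ.∣ q ∣ ℚ.< η → ℚ.∣ p ℚ.* q ∣ ℚ.< B ℚ.* η
  ∣p*q∣<B*η {p} {q} {B} {η} 0<B p≤B q<η = begin-strict
    ℚ.∣ p ℚ.* q ∣         ≡⟨ ℚ.∣p*q∣≡∣p∣*∣q∣ p q ⟩
    ℚ.∣ p ∣ ℚ.* ℚ.∣ q ∣   ≤⟨ ℚ.*-monoʳ-≤-nonNeg ℚ.∣ q ∣ {{ℚ.∣-∣-nonNeg q}} p≤B ⟩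
    B ℚ.* ℚ.∣ q ∣         <⟨ ℚ.*-monoʳ-<-pos B {{ℚ.positive 0<B}} q<η ⟩
    B ℚ.* η               ∎

fromℚ : ℚ → ℝ
fromℚ q = mkℝ (λ _ → q) λ δ 0<δ →
  0 , λ _ _ → subst (ℚ._< δ) (sym (cong ℚ.∣_∣ (ℚ.+-inverseʳ q))) 0<δ

fromℕ : ℕ → ℝ
fromℕ n = fromℚ (+ n ℚ./ 1)

0ℝ : ℝ
0ℝ = fromℚ 0ℚ

infix  8 -_
infixl 7 _*_
infixl 6 _+_ _-_

_+_ : ℝ → ℝ → ℝ
seq (x + y) n = seq x n ℚ.+ seq y n
cauchy (x + y) δ 0<δ
  with cauchy x (½ ℚ.* δ) (0<½*p 0<δ) | cauchy y (½ ℚ.* δ) (0<½*p 0<δ)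
... | N₁ , close₁ | N₂ , close₂ = N₁ ℕ.⊔ N₂ , λ {m} {n} N≤m N≤n → begin-strict
  ℚ.∣ (seq x m ℚ.+ seq y m) ℚ.- (seq x n ℚ.+ seq y n) ∣
    ≡⟨ cong ℚ.∣_∣ (sub-+ (seq x m) (seq y m) (seq x n) (seq y n)) ⟩
  ℚ.∣ (seq x m ℚ.- seq x n) ℚ.+ (seq y m ℚ.- seq y n) ∣
    ≤⟨ ℚ.∣p+q∣≤∣p∣+∣q∣ (seq x m ℚ.- seq x n) (seq y m ℚ.- seq y n) ⟩
  ℚ.∣ seq x m ℚ.- seq x n ∣ ℚ.+ ℚ.∣ seq y m ℚ.- seq y n ∣
    <⟨ ℚ.+-mono-< (close₁ (ℕ.m⊔n≤o⇒m≤o N₁ N₂ N≤m) (ℕ.m⊔n≤o⇒m≤o N₁ N₂ N≤n))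
                  (close₂ (ℕ.m⊔n≤o⇒n≤o N₁ N₂ N≤m) (ℕ.m⊔n≤o⇒n≤o N₁ N₂ N≤n)) ⟩
  ½ ℚ.* δ ℚ.+ ½ ℚ.* δ
    ≡⟨ ½p+½p δ ⟩
  δ ∎

-_ : ℝ → ℝ
seq (- x) n = ℚ.- seq x n
cauchy (- x) δ 0<δ with cauchy x δ 0<δ
... | N , close = N , λ {m} {n} N≤m N≤n → subst (ℚ._< δ)
  (sym (trans (cong ℚ.∣_∣ (sub-neg (seq x m) (seq x n)))
              (ℚ.∣-p∣≡∣p∣ (seq x m ℚ.- seq x n))))
  (close N≤m N≤n)

_-_ : ℝ → ℝ → ℝ
x - y = x + (- y)

_*_ : ℝ → ℝ → ℝ
seq (x * y) n = seq x n ℚ.* seq y n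
cauchy (x * y) δ 0<δ = N , close
  where
  bx : ∃[ B ] 0ℚ ℚ.< B × ∃[ N ] ∀ {n} → N ℕ.≤ n → ℚ.∣ seq x n ∣ ℚ.≤ B
  bx = bounded (cauchy x)
  by : ∃[ B ] 0ℚ ℚ.< B × ∃[ N ] ∀ {n} → N ℕ.≤ n → ℚ.∣ seq y n ∣ ℚ.≤ B
  by = bounded (cauchy y)
  B₁ B₂ B : ℚ
  B₁ = proj₁ bx
  B₂ = proj₁ by
  B  = B₁ ℚ.+ B₂
  0<B : 0ℚ ℚ.< B
  0<B = ℚ.+-mono-< (proj₁ (proj₂ bx)) (proj₁ (proj₂ by))
  B₁≤B : B₁ ℚ.≤ B
  B₁≤B = subst (ℚ._≤ B) (ℚ.+-identityʳ B₁)
    (ℚ.+-monoʳ-≤ B₁ (ℚ.<⇒≤ (proj₁ (proj₂ by))))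
  B₂≤B : B₂ ℚ.≤ B
  B₂≤B = subst (ℚ._≤ B) (ℚ.+-identityˡ B₂)
    (ℚ.+-monoˡ-≤ B₂ (ℚ.<⇒≤ (proj₁ (proj₂ bx))))
  instance
    B-pos : ℚ.Positive B
    B-pos = ℚ.positive 0<B
    B-nonZero : ℚ.NonZero B
    B-nonZero = ℚ.pos⇒nonZero B
  η : ℚ
  η = ℚ.1/ B ℚ.* (½ ℚ.* δ)
  0<η : 0ℚ ℚ.< η
  0<η = subst (ℚ._< η) (ℚ.*-zeroʳ (ℚ.1/ B))
    (ℚ.*-monoʳ-<-pos (ℚ.1/ B) {{ℚ.1/pos⇒pos B}} (0<½*p 0<δ))
  Bη : B ℚ.* η ≡ ½ ℚ.* δ
  Bη = trans (sym (ℚ.*-assoc B (ℚ.1/ B) (½ ℚ.* δ)))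
    (trans (cong (ℚ._* (½ ℚ.* δ)) (ℚ.*-inverseʳ B)) (ℚ.*-identityˡ (½ ℚ.* δ)))
  N₁ N₂ N₃ N₄ N : ℕ
  N₁ = proj₁ (proj₂ (proj₂ bx))
  N₂ = proj₁ (proj₂ (proj₂ by))
  N₃ = proj₁ (cauchy x η 0<η)
  N₄ = proj₁ (cauchy y η 0<η)
  N  = (N₁ ℕ.⊔ N₂) ℕ.⊔ (N₃ ℕ.⊔ N₄)
  ≤N₁ : ∀ {m} → N ℕ.≤ m → N₁ ℕ.≤ m
  ≤N₁ h = ℕ.m⊔n≤o⇒m≤o N₁ N₂ (ℕ.m⊔n≤o⇒m≤o _ (N₃ ℕ.⊔ N₄) h)
  ≤N₂ : ∀ {m} → N ℕ.≤ m → N₂ ℕ.≤ m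
  ≤N₂ h = ℕ.m⊔n≤o⇒n≤o N₁ N₂ (ℕ.m⊔n≤o⇒m≤o _ (N₃ ℕ.⊔ N₄) h)
  ≤N₃ : ∀ {m} → N ℕ.≤ m → N₃ ℕ.≤ m
  ≤N₃ h = ℕ.m⊔n≤o⇒m≤o N₃ N₄ (ℕ.m⊔n≤o⇒n≤o (N₁ ℕ.⊔ N₂) _ h)
  ≤N₄ : ∀ {m} → N ℕ.≤ m → N₄ ℕ.≤ m
  ≤N₄ h = ℕ.m⊔n≤o⇒n≤o N₃ N₄ (ℕ.m⊔n≤o⇒n≤o (N₁ ℕ.⊔ N₂) _ h)
  close : ∀ {m n} → N ℕ.≤ m → N ℕ.≤ n →
    ℚ.∣ seq x m ℚ.* seq y m ℚ.- seq x n ℚ.* seq y n ∣ ℚ.< δ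
  close {m} {n} N≤m N≤n = begin-strict
    ℚ.∣ seq x m ℚ.* seq y m ℚ.- seq x n ℚ.* seq y n ∣
      ≡⟨ cong ℚ.∣_∣ (sub-* (seq x m) (seq y m) (seq x n) (seq y n)) ⟩
    ℚ.∣ u ℚ.+ v ∣
      ≤⟨ ℚ.∣p+q∣≤∣p∣+∣q∣ u v ⟩
    ℚ.∣ u ∣ ℚ.+ ℚ.∣ v ∣
      <⟨ ℚ.+-mono-<
           (∣p*q∣<B*η {p = seq x m} 0<B
             (ℚ.≤-trans (proj₂ (proj₂ (proj₂ bx)) (≤N₁ N≤m)) B₁≤B)
             (proj₂ (cauchy y η 0<η) (≤N₄ N≤m) (≤N₄ N≤n)))
           (∣p*q∣<B*η {p = seq y n} 0<B
             (ℚ.≤-trans (proj₂ (proj₂ (proj₂ by)) (≤N₂ N≤n)) B₂≤B)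
             (proj₂ (cauchy x η 0<η) (≤N₃ N≤m) (≤N₃ N≤n))) ⟩
    B ℚ.* η ℚ.+ B ℚ.* η
      ≡⟨ cong₂ ℚ._+_ Bη Bη ⟩
    ½ ℚ.* δ ℚ.+ ½ ℚ.* δ
      ≡⟨ ½p+½p δ ⟩
    δ ∎
    where
    u v : ℚ
    u = seq x m ℚ.* (seq y m ℚ.- seq y n)
    v = seq y n ℚ.* (seq x m ℚ.- seq x n)

------------------------------------------------------------------------
-- Binary logarithm

private
  2^⌊log₂n⌋≤n : ∀ k n .{{_ : ℕ.NonZero n}} → ⌊log₂ n ⌋ ≡ k → 2 ℕ.^ k ℕ.≤ n
  2^⌊log₂n⌋≤n k n eq with ℕ.≤-<-connex (2 ℕ.^ k) n
  2^⌊log₂n⌋≤n k n eq | inj₁ h = h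
  2^⌊log₂n⌋≤n zero n@(suc _) eq | inj₂ h = s≤s z≤n
  2^⌊log₂n⌋≤n (suc k) 1 () | inj₂ _
  2^⌊log₂n⌋≤n (suc k) n@(suc (suc n′)) eq | inj₂ h = contradiction
    (2^⌊log₂n⌋≤n k ℕ.⌊ n /2⌋ (trans (⌊log₂⌊n/2⌋⌋≡⌊log₂n⌋∸1 n) (cong ℕ.pred eq)))
    λ le → ℕ.<⇒≱ h (ℕ.≤-trans (ℕ.*-monoʳ-≤ 2 le) (2⌊m/2⌋≤m n))
    where
    2⌊m/2⌋≤m : ∀ m → 2 ℕ.* ℕ.⌊ m /2⌋ ℕ.≤ m
    2⌊m/2⌋≤m m = subst₂ ℕ._≤_
      (cong (ℕ.⌊ m /2⌋ ℕ.+_) (sym (ℕ.+-identityʳ _)))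
      (ℕ.⌊n/2⌋+⌈n/2⌉≡n m)
      (ℕ.+-monoʳ-≤ ℕ.⌊ m /2⌋ (ℕ.⌊n/2⌋≤⌈n/2⌉ m))

  n<2^1+⌊log₂n⌋ : ∀ n → n ℕ.< 2 ℕ.^ suc ⌊log₂ n ⌋
  n<2^1+⌊log₂n⌋ n with ℕ.≤-<-connex (2 ℕ.^ suc ⌊log₂ n ⌋) n
  ... | inj₂ h = h
  ... | inj₁ h = contradiction
    (subst (ℕ._≤ ⌊log₂ n ⌋) (⌊log₂[2^n]⌋≡n (suc ⌊log₂ n ⌋)) (⌊log₂⌋-mono-≤ h))
    (ℕ.<⇒≱ ℕ.≤-refl)

  2^-cancel-< : ∀ {a b} → 2 ℕ.^ a ℕ.< 2 ℕ.^ b → a ℕ.< b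
  2^-cancel-< {a} {b} h with ℕ.≤-<-connex b a
  ... | inj₂ a<b = a<b
  ... | inj₁ b≤a = contradiction (ℕ.^-monoʳ-≤ 2 b≤a) (ℕ.<⇒≱ h)

  cross : ∀ n m l →
    ⌊log₂ n ℕ.^ suc m ⌋ ℕ.* suc l ℕ.< suc ⌊log₂ n ℕ.^ suc l ⌋ ℕ.* suc m
  cross zero    m l = s≤s z≤n
  cross n@(suc _) m l = 2^-cancel-< (ℕ.≤-<-trans lower upper)
    where
    a b : ℕ
    a = ⌊log₂ n ℕ.^ suc m ⌋
    b = suc ⌊log₂ n ℕ.^ suc l ⌋
    instance
      nz : ℕ.NonZero (n ℕ.^ suc m)
      nz = ℕ.m^n≢0 n (suc m)
    lower : 2 ℕ.^ (a ℕ.* suc l) ℕ.≤ n ℕ.^ (suc m ℕ.* suc l)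
    lower = subst₂ ℕ._≤_ (ℕ.^-*-assoc 2 a (suc l)) (ℕ.^-*-assoc n (suc m) (suc l))
      (ℕ.^-monoˡ-≤ (suc l) (2^⌊log₂n⌋≤n a (n ℕ.^ suc m) refl))
    upper : n ℕ.^ (suc m ℕ.* suc l) ℕ.< 2 ℕ.^ (b ℕ.* suc m)
    upper = subst₂ ℕ._<_
      (trans (ℕ.^-*-assoc n (suc l) (suc m)) (cong (n ℕ.^_) (ℕ.*-comm (suc l) (suc m))))
      (ℕ.^-*-assoc 2 b (suc m))
      (ℕ.^-monoˡ-< (suc m) (n<2^1+⌊log₂n⌋ (n ℕ.^ suc l)))

  /-mono-< : ∀ a b m l → a ℕ.* suc l ℕ.< b ℕ.* suc m →
    + a ℚ./ suc m ℚ.< + b ℚ./ suc l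
  /-mono-< a b m l h = ℚ.toℚᵘ-cancel-<
    (ℚᵘ.<-respˡ-≃ (ℚᵘ.≃-sym (ℚ.toℚᵘ-fromℚᵘ (mkℚᵘ (+ a) m)))
    (ℚᵘ.<-respʳ-≃ (ℚᵘ.≃-sym (ℚ.toℚᵘ-fromℚᵘ (mkℚᵘ (+ b) l)))
    (ℚᵘ.*<* (subst₂ ℤ._<_ (ℤ.pos-* a (suc l)) (ℤ.pos-* b (suc m)) (ℤ.+<+ h)))))

  suc-/ : ∀ a l → + suc a ℚ./ suc l ≡ + a ℚ./ suc l ℚ.+ + 1 ℚ./ suc l
  suc-/ a l = ℚ.toℚᵘ-injective (ℚᵘ.≃-trans
    (ℚ.toℚᵘ-fromℚᵘ (mkℚᵘ (+ suc a) l))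
    (ℚᵘ.≃-trans add (ℚᵘ.≃-sym (ℚᵘ.≃-trans
      (ℚ.toℚᵘ-homo-+ (+ a ℚ./ suc l) (+ 1 ℚ./ suc l))
      (ℚᵘ.+-cong (ℚ.toℚᵘ-fromℚᵘ (mkℚᵘ (+ a) l)) (ℚ.toℚᵘ-fromℚᵘ (mkℚᵘ (+ 1) l)))))))
    where
    L : ℤ
    L = + suc l
    add : mkℚᵘ (+ suc a) l ℚᵘ.≃ mkℚᵘ (+ a) l ℚᵘ.+ mkℚᵘ (+ 1) l
    add = ℚᵘ.*≡* (trans
      (sym (ℤ.*-assoc (+ suc a) L L))
      (cong (ℤ._* L) (trans (cong (ℤ._* L) (cong +_ (ℕ.+-comm 1 a)))
        (ℤ.*-distribʳ-+ L (+ a) (+ 1)))))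

  1/-< : ∀ {δ} → 0ℚ ℚ.< δ → ∃[ N ] ∀ {l} → N ℕ.≤ l → + 1 ℚ./ suc l ℚ.< δ
  1/-< {ℚ.mkℚ (+ suc p) d c} _ = suc d , λ {l} h → ℚ.toℚᵘ-cancel-<
    (ℚᵘ.<-respˡ-≃ (ℚᵘ.≃-sym (ℚ.toℚᵘ-fromℚᵘ (mkℚᵘ (+ 1) l)))
    (ℚᵘ.*<* (subst₂ ℤ._<_ (ℤ.pos-* 1 (suc d)) (ℤ.pos-* (suc p) (suc l))
      (ℤ.+<+ (subst (ℕ._< suc p ℕ.* suc l) (sym (ℕ.*-identityˡ (suc d)))
        (ℕ.≤-trans (s≤s h) (ℕ.m≤m+n (suc l) (p ℕ.* suc l))))))))
  1/-< {ℚ.mkℚ (+ zero) d c} (ℚ.*<* (ℤ.+<+ ()))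
  1/-< {ℚ.mkℚ ℤ.-[1+ p ] d c} (ℚ.*<* ())

  minus-< : ∀ {p q r} → p ℚ.< q ℚ.+ r → p ℚ.- q ℚ.< r
  minus-< {p} {q} {r} h =
    subst (p ℚ.- q ℚ.<_) (cancel q r) (ℚ.+-monoˡ-< (ℚ.- q) h)
    where
    open +-*-Solver
    cancel : ∀ q r → q ℚ.+ r ℚ.- q ≡ r
    cancel = solve 2 (λ q r → q :+ r :- q := r) refl

-- log₂ n is the limit of ⌊log₂ (nʲ)⌋ / j as j → ∞; indeed
-- ⌊log₂ (nʲ)⌋ / j ≤ log₂ n < ⌊log₂ (nʲ)⌋ / j + 1 / j  for n ≥ 1.
-- As for ⌊log₂_⌋, the value at n = 0 is the conventional 0.
log₂ : ℕ → ℝ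
seq (log₂ n) j = + ⌊log₂ n ℕ.^ suc j ⌋ ℚ./ suc j
cauchy (log₂ n) δ 0<δ with 1/-< 0<δ
... | N , small = N , λ {m} {l} N≤m N≤l → ∣p∣<q
  (ℚ.<-trans (gap m l) (small N≤l))
  (subst (ℚ._< δ) (neg-sub (s l) (s m)) (ℚ.<-trans (gap l m) (small N≤m)))
  where
  s : ℕ → ℚ
  s j = + ⌊log₂ n ℕ.^ suc j ⌋ ℚ./ suc j
  gap : ∀ m l → s m ℚ.- s l ℚ.< + 1 ℚ./ suc l
  gap m l = minus-< (subst (s m ℚ.<_) (suc-/ ⌊log₂ n ℕ.^ suc l ⌋ l)
    (/-mono-< ⌊log₂ n ℕ.^ suc m ⌋ (suc ⌊log₂ n ℕ.^ suc l ⌋) m l (cross n m l)))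
  open +-*-Solver
  neg-sub : ∀ a b → a ℚ.- b ≡ ℚ.- (b ℚ.- a)
  neg-sub = solve 2 (λ a b → a :- b := :- (b :- a)) refl

------------------------------------------------------------------------
-- Graphs

record Graph (n : ℕ) : Set₁ where
  field
    Adj    : Rel (Fin n) 0ℓ
    symm   : Symmetric Adj
    irrefl : Irreflexive _≡_ Adj

open Graph public

infix 4 _≅_

record _≅_ {m n} (G : Graph m) (H : Graph n) : Set where
  field
    bijection : Permutation m n
    preserves : ∀ i j →
      Adj G i j ⇔ Adj H (bijection ⟨$⟩ʳ i) (bijection ⟨$⟩ʳ j)

------------------------------------------------------------------------
-- Points and slopes

Point : Set
Point = ℝ × ℝ

_≈ₚ_ : Rel Point 0ℓ
(x , y) ≈ₚ (x′ , y′) = x ≈ x′ × y ≈ y′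

data Slope : Set where
  finite : ℝ → Slope
  ∞      : Slope

data _≈ₛ_ : Rel Slope 0ℓ where
  finite : ∀ {a b} → a ≈ b → finite a ≈ₛ finite b
  ∞      : ∞ ≈ₛ ∞

-- An m-element set of points and a k-element set of slopes are given by
-- enumerations without repetition.
record PointSet (m : ℕ) : Set where
  field
    point    : Fin m → Point
    distinct : Injective _≡_ _≈ₚ_ point

record SlopeSet (k : ℕ) : Set where
  field
    slope    : Fin k → Slope
    distinct : Injective _≡_ _≈ₛ_ slope

open PointSet public using (point)
open SlopeSet public using (slope)

-- For distinct points v and w: the slope of the line through v and w.
-- A non-vertical line has slope a when rise = a · run.
LineHasSlope : Point → Point → Slope → Set
LineHasSlope (x , y) (x′ , y′) (finite a) = ¬ (x ≈ x′) × (y′ - y) ≈ a * (x′ - x)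
LineHasSlope (x , y) (x′ , y′) ∞          = x ≈ x′

private
  ≈-sym : ∀ {x y} → x ≈ y → y ≈ x
  ≈-sym {x} {y} x≈y δ 0<δ with x≈y δ 0<δ
  ... | N , close = N , λ {n} N≤n → subst (ℚ._< δ)
    (trans (sym (ℚ.∣-p∣≡∣p∣ (seq x n ℚ.- seq y n)))
           (cong ℚ.∣_∣ (neg-sub (seq x n) (seq y n))))
    (close N≤n)
    where
    open +-*-Solver
    neg-sub : ∀ a b → ℚ.- (a ℚ.- b) ≡ b ℚ.- a
    neg-sub = solve 2 (λ a b → :- (a :- b) := b :- a) refl

  LineHasSlope-sym : ∀ v w s → LineHasSlope v w s → LineHasSlope w v s
  LineHasSlope-sym (x , y) (x′ , y′) ∞ x≈x′ = ≈-sym {x} {x′} x≈x′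
  LineHasSlope-sym (x , y) (x′ , y′) (finite a) (x≉x′ , eq) =
    (λ x′≈x → x≉x′ (≈-sym {x′} {x} x′≈x)) , λ δ 0<δ → flip-close δ (eq δ 0<δ)
    where
    open +-*-Solver
    flip-eq : ∀ x y x′ y′ a →
      ℚ.- ((y′ ℚ.- y) ℚ.- a ℚ.* (x′ ℚ.- x)) ≡ (y ℚ.- y′) ℚ.- a ℚ.* (x ℚ.- x′)
    flip-eq = solve 5 (λ x y x′ y′ a →
      :- ((y′ :- y) :- a :* (x′ :- x)) := (y :- y′) :- a :* (x :- x′)) refl
    flip-close : ∀ δ →
      (∃[ N ] ∀ {n} → N ℕ.≤ n → ℚ.∣ seq (y′ - y) n ℚ.- seq (a * (x′ - x)) n ∣ ℚ.< δ) →
      (∃[ N ] ∀ {n} → N ℕ.≤ n → ℚ.∣ seq (y - y′) n ℚ.- seq (a * (x - x′)) n ∣ ℚ.< δ)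
    flip-close δ (N , close) = N , λ {n} N≤n → subst (ℚ._< δ)
      (trans (sym (ℚ.∣-p∣≡∣p∣ (seq (y′ - y) n ℚ.- seq (a * (x′ - x)) n)))
             (cong ℚ.∣_∣ (flip-eq (seq x n) (seq y n) (seq x′ n) (seq y′ n) (seq a n))))
      (close N≤n)

G⟨_,_⟩ : ∀ {m k} → PointSet m → SlopeSet k → Graph m
Adj    G⟨ P , S ⟩ v w =
  v ≢ w × ∃[ s ] LineHasSlope (point P v) (point P w) (slope S s)
symm   G⟨ P , S ⟩ {v} {w} (v≢w , s , h) =
  ≢-sym v≢w , s , LineHasSlope-sym (point P v) (point P w) (slope S s) h
irrefl G⟨ P , S ⟩ v≡w (v≢w , _) = v≢w v≡w

------------------------------------------------------------------------
-- The slope parameter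

Representable : ∀ {n} → Graph n → ℕ → Set
Representable G k =
  ∃[ m ] Σ (PointSet m) λ P → Σ (SlopeSet k) λ S → G ≅ G⟨ P , S ⟩

-- sl(G) = k
IsSlopeParameter : ∀ {n} → Graph n → ℕ → Set
IsSlopeParameter G k =
  Representable G k × (∀ j → Representable G j → k ℕ.≤ j)

module Submission where

-- Write m = n (n - 1) / 2.  For a set S of pairs of vertices let G_S be the graph whose non-edges are
-- the pairs in S.  If G_S is drawn with at most K slopes, then the polynomial f_p, the product over all
-- slopes a of (y_w - y_v) - a (x_w - x_v) for the pair p = (v , w), is nonzero at the drawing u_S exactly
-- when p is in S.  Hence the product F_T of the f_p with p in T does not vanish at u_S if and only if
-- T ⊆ S, so the 2 ^ m polynomials F_S are linearly independent.  They have degree at most m in each slope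
-- and at most m K in each coordinate, which gives 2 ^ m ≤ (m + 3) ^ K (m K + 1) ^ (2 n) if all graphs
-- can be drawn with K slopes.  As m < n² / 2, this forces K to be about n² / (4 log n).
--
-- This is the bound of Rónyai, Babai and Ganapathy on zero patterns, with the degrees counted in each
-- variable separately; it replaces Warren's theorem on sign patterns.

open import Algebra.Bundles using (CommutativeRing; CommutativeSemiring)
import Algebra.Properties.Group
open import Axiom.DoubleNegationElimination using (em⇒dne)
open import Axiom.ExcludedMiddle using (ExcludedMiddle)
open import Data.Empty using (⊥-elim)
open import Data.Fin.Base as Fin using (Fin; zero; suc; toℕ)
open import Data.Fin.Permutation as Permutation using (_⟨$⟩ʳ_)
import Data.Fin.Properties as Fin
open import Data.Integer.Base as ℤ using (+_)
import Data.Integer.Properties as ℤ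
open import Data.List.Base as List
  using (List; []; _∷_; _++_; length; map; allFin; applyUpTo; cartesianProductWith; filter)
import Data.List.Membership.DecPropositional as DecMembership
open import Data.List.Membership.Propositional using (_∈_)
open import Data.List.Membership.Propositional.Properties hiding (finite)
open import Data.List.Properties using (length-map; length-applyUpTo; length-++; length-tabulate)
open import Data.List.Relation.Binary.Subset.Propositional using (_⊆_)
open import Data.List.Relation.Unary.All as All using (All; []; _∷_)
import Data.List.Relation.Unary.All.Properties as All
open import Data.List.Relation.Unary.AllPairs as AllPairs using (AllPairs; []; _∷_)
import Data.List.Relation.Unary.AllPairs.Properties as AllPairs
open import Data.List.Relation.Unary.Any as Any using (here; there)
import Data.List.Relation.Unary.Any.Properties as Any
open import Data.List.Relation.Unary.Unique.Propositional using (Unique)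
import Data.List.Relation.Unary.Unique.Propositional.Properties as Unique
open import Data.Nat.Base as ℕ using (ℕ; zero; suc; z≤n; s≤s)
open import Data.Nat.Logarithm using (⌊log₂_⌋; ⌊log₂⌋-mono-≤; ⌊log₂[2^n]⌋≡n)
import Data.Nat.Properties as ℕ
import Data.Nat.Solver as ℕ
open import Data.Product.Base using (Σ; ∃₂; ∃-syntax; _×_; _,_; proj₁; proj₂)
import Data.Product.Properties as Product
open import Data.Rational.Base as ℚ using (ℚ; 0ℚ; 1ℚ; ½)
import Data.Rational.Properties as ℚ
import Data.Rational.Solver as ℚ
open import Data.Rational.Unnormalised.Base as ℚᵘ using (mkℚᵘ)
import Data.Rational.Unnormalised.Properties as ℚᵘ
open import Data.Sum.Base using (_⊎_; inj₁; inj₂; [_,_]′)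
open import Data.Unit.Base using (⊤; tt)
open import Function.Base using (_∋_)
open import Function.Bundles using (_⇔_; mk⇔; Equivalence; Injection)
open import Function.Properties.Inverse using (↔⇒↣)
open import Level using (0ℓ)
open import Relation.Binary.Bundles using (Setoid)
open import Relation.Binary.Definitions using (Decidable; tri<; tri≈; tri>)
open import Relation.Binary.PropositionalEquality as ≡ using (_≡_; _≢_)
open import Relation.Nullary using (¬_; Dec; yes; no; contradiction; ¬?)

-- The constant 4 comes from the slopes alone. A slope occurs in only one factor of each f_p, so its
-- degree in a product stays at most m, whatever K is; since m + 3 ≤ n², the K slopes contribute at
-- most n ^ (2 K) to the dimension, against 2 ^ m with m close to n² / 2. The degree in a coordinate
-- does grow with K, but K is below n² in the range of interest, so the 2 n coordinates contribute
-- at most n ^ (8 n), which ε absorbs.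
--
-- No formal polynomials occur: everything is a real function on the set of configurations, a space
-- is a list of generators, and its dimension is bounded by the length of that list. Independence is
-- read off from the values at the u_S, which form a triangular matrix once every set is listed
-- after its proper subsets. Elimination must decide whether a real number is zero; this is one use
-- of excluded middle, others being the choice of a graph and of a least number of slopes.
--
-- A slope parameter must also be shown to exist, so each G_S needs some drawing; this is why points
-- on a parabola appear.

subsets : {P : Set} → List P → List (List P)
subsets []       = [] ∷ []
subsets (p ∷ ps) = subsets ps ++ map (p ∷_) (subsets ps)

module _ {P : Set} where

  length-subsets : ∀ (ps : List P) → length (subsets ps) ≡ 2 ℕ.^ length ps
  length-subsets []       = ≡.refl
  length-subsets (p ∷ ps) = ≡.trans (length-++ (subsets ps)) (≡.cong₂ ℕ._+_ (length-subsets ps)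
    (≡.trans (length-map (p ∷_) (subsets ps))
      (≡.trans (length-subsets ps) (≡.sym (ℕ.+-identityʳ _)))))

  subsets-⊆ : ∀ (ps : List P) {S} → S ∈ subsets ps → S ⊆ ps
  subsets-⊆ []       (here ≡.refl) p∈S = p∈S
  subsets-⊆ (p ∷ ps) S∈ with ∈-++⁻ (subsets ps) S∈
  ... | inj₁ S∈′ = λ p∈S → there (subsets-⊆ ps S∈′ p∈S)
  ... | inj₂ S∈′ with ∈-map⁻ (p ∷_) S∈′
  ...   | T , T∈ , ≡.refl = λ { (here ≡.refl) → here ≡.refl ; (there p∈T) → there (subsets-⊆ ps T∈ p∈T) }

  []∈subsets : ∀ (ps : List P) → [] ∈ subsets ps
  []∈subsets []       = here ≡.refl
  []∈subsets (p ∷ ps) = ∈-++⁺ˡ ([]∈subsets ps)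

  Separated : List P → List P → List P → Set
  Separated ps S T = ∃[ p ] p ∈ ps × p ∈ T × ¬ p ∈ S

  -- The lists without `p` come before those with `p`, so `p` separates any pair from different
  -- halves; inside a half the witness is inherited. No later set is contained in an earlier one,
  -- which makes the evaluation matrix of the products triangular.
  subsets-separated : ∀ {ps : List P} → Unique ps → AllPairs (Separated ps) (subsets ps)
  subsets-separated {[]}     _          = [] ∷ []
  subsets-separated {p ∷ ps} (p∉ ∷ ps!) = AllPairs.++⁺
    (AllPairs.map (λ (p′ , p′∈ , p′∈T , p′∉S) → p′ , there p′∈ , p′∈T , p′∉S) ih)
    (AllPairs.map⁺ (AllPairs.map
      (λ (p′ , p′∈ , p′∈T , p′∉S) → p′ , there p′∈ , there p′∈T , λ
        { (here p′≡p)   → All.lookup p∉ p′∈ (≡.sym p′≡p)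
        ; (there p′∈S) → p′∉S p′∈S })
      ih))
    (All.tabulate λ S∈ → All.map⁺ (All.tabulate λ _ →
      p , here ≡.refl , here ≡.refl , λ p∈S → All.lookup p∉ (subsets-⊆ ps S∈ p∈S) ≡.refl))
    where
    ih : AllPairs (Separated ps) (subsets ps)
    ih = subsets-separated ps!

-- Pairs of vertices

Edge : ℕ → Set
Edge n = Fin n × Fin n

edges : ∀ n → List (Edge n)
edges zero    = []
edges (suc n) = map (λ j → zero , suc j) (allFin n) ++ map (λ (i , j) → suc i , suc j) (edges n)

edges-< : ∀ n {i j} → (i , j) ∈ edges n → i Fin.< j
edges-< (suc n) e∈ with ∈-++⁻ (map (λ j → zero , suc j) (allFin n)) e∈
... | inj₁ e∈′ with ∈-map⁻ (λ j → zero , suc j) e∈′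
...   | _ , _ , ≡.refl = s≤s z≤n
edges-< (suc n) e∈ | inj₂ e∈′ with ∈-map⁻ (λ (i , j) → suc i , suc j) e∈′
...   | _ , e∈″ , ≡.refl = s≤s (edges-< n e∈″)

edges-complete : ∀ n {i j} → i Fin.< j → (i , j) ∈ edges n
edges-complete (suc n) {zero} {suc j} _ = ∈-++⁺ˡ (∈-map⁺ (λ j → zero , suc j) (∈-allFin j))
edges-complete (suc n) {suc i} {suc j} (s≤s i<j) =
  ∈-++⁺ʳ _ (∈-map⁺ (λ (i , j) → suc i , suc j) (edges-complete n i<j))

edges-unique : ∀ n → Unique (edges n)
edges-unique zero    = []
edges-unique (suc n) = Unique.++⁺
  (Unique.map⁺ (λ { ≡.refl → ≡.refl }) (Unique.allFin⁺ n))
  (Unique.map⁺ (λ { ≡.refl → ≡.refl }) (edges-unique n))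
  λ (e∈₁ , e∈₂) → disjoint (∈-map⁻ _ e∈₁) (∈-map⁻ _ e∈₂)
  where
  disjoint : ∀ {e} → (∃[ j ] j ∈ allFin n × e ≡ (zero , suc j)) →
    ¬ (∃[ e′ ] e′ ∈ edges n × e ≡ (suc (proj₁ e′) , suc (proj₂ e′)))
  disjoint (_ , _ , ≡.refl) (_ , _ , ())

length-edges : ∀ n → 2 ℕ.* length (edges n) ℕ.+ n ≡ n ℕ.* n
length-edges zero    = ≡.refl
length-edges (suc n) = begin
  2 ℕ.* length (edges (suc n)) ℕ.+ suc n              ≡⟨ ≡.cong (λ l → 2 ℕ.* l ℕ.+ suc n) step ⟩
  2 ℕ.* (n ℕ.+ length (edges n)) ℕ.+ suc n            ≡⟨ rearrange n (length (edges n)) ⟩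
  (2 ℕ.* length (edges n) ℕ.+ n) ℕ.+ (n ℕ.+ suc n)    ≡⟨ ≡.cong (ℕ._+ (n ℕ.+ suc n)) (length-edges n) ⟩
  n ℕ.* n ℕ.+ (n ℕ.+ suc n)                           ≡⟨ square n ⟩
  suc n ℕ.* suc n                                     ∎
  where
  open ≡.≡-Reasoning
  open ℕ.+-*-Solver using (solve; _:=_; _:+_; _:*_; con)
  step : length (edges (suc n)) ≡ n ℕ.+ length (edges n)
  step = ≡.trans (length-++ (map (λ j → zero , suc j) (allFin n))) (≡.cong₂ ℕ._+_
    (≡.trans (length-map (λ j → (Edge (suc n) ∋ (zero , suc j))) (allFin n)) (length-tabulate {n = n} (λ i → i)))
    (length-map _ (edges n)))
  rearrange : ∀ n m → 2 ℕ.* (n ℕ.+ m) ℕ.+ suc n ≡ (2 ℕ.* m ℕ.+ n) ℕ.+ (n ℕ.+ suc n)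
  rearrange = solve 2 (λ n m → con 2 :* (n :+ m) :+ (con 1 :+ n) := (con 2 :* m :+ n) :+ (n :+ (con 1 :+ n))) ≡.refl
  square : ∀ n → n ℕ.* n ℕ.+ (n ℕ.+ suc n) ≡ suc n ℕ.* suc n
  square = solve 1 (λ n → n :* n :+ (n :+ (con 1 :+ n)) := (con 1 :+ n) :* (con 1 :+ n)) ≡.refl

-- Spaces of functions spanned by monomials

module SemiringIdentities (R : CommutativeSemiring 0ℓ 0ℓ) where
  open CommutativeSemiring R
  open import Algebra.Solver.Ring.NaturalCoefficients.Default R

  combine : ∀ a b c d e → (a * b + c) + (d * b + e) ≈ (a + d) * b + (c + e)
  combine = solve 5 (λ a b c d e → (a :* b :+ c) :+ (d :* b :+ e) := (a :+ d) :* b :+ (c :+ e)) refl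

  rescale : ∀ a b c d → d * (a * b + c) ≈ (d * a) * b + d * c
  rescale = solve 4 (λ a b c d → d :* (a :* b :+ c) := (d :* a) :* b :+ d :* c) refl

  -- In the elimination step `d′` is `- d`, so the last summand vanishes and `b` drops out; a
  -- separate variable keeps negation out of the semiring identity.
  regroup : ∀ c b g d d′ h → c * (d * b + h) + d′ * (c * b + g) ≈ (c * h + d′ * g) + (d + d′) * (c * b)
  regroup = solve 6 (λ c b g d d′ h →
    c :* (d :* b :+ h) :+ d′ :* (c :* b :+ g) := (c :* h :+ d′ :* g) :+ (d :+ d′) :* (c :* b)) refl

  *-leftComm : ∀ c a b → c * (a * b) ≈ a * (c * b)
  *-leftComm = solve 3 (λ c a b → c :* (a :* b) := a :* (c :* b)) refl

  *-interchange : ∀ a b c d → (a * c) * (b * d) ≈ (a * b) * (c * d)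
  *-interchange = solve 4 (λ a b c d → (a :* c) :* (b :* d) := (a :* b) :* (c :* d)) refl

module FunctionSpace (R : CommutativeRing 0ℓ 0ℓ) where
  open CommutativeRing R hiding (zero) renaming (Carrier to A)
  module Ring = SemiringIdentities commutativeSemiring
  open import Algebra.Properties.CommutativeSemiring.Exp commutativeSemiring using (_^_; ^-homo-*)

  open import Algebra.Properties.Ring ring using (-1*x≈-x)

  private
    variable
      X Y : Set

  -- Functions are compared pointwise, hence `resp`. Coefficients are not stored: `span-∷` recovers
  -- the only one that elimination needs.
  data Span {X : Set} (B : List (X → A)) : (X → A) → Set where
    gen   : ∀ {b} → b ∈ B → Span B b
    0ₛ    : Span B (λ _ → 0#)
    add   : ∀ {f g} → Span B f → Span B g → Span B (λ x → f x + g x)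
    scale : ∀ {f} c → Span B f → Span B (λ x → c * f x)
    resp  : ∀ {f g} → (∀ x → f x ≈ g x) → Span B f → Span B g

  span-[] : ∀ {f : X → A} → Span [] f → ∀ x → f x ≈ 0#
  span-[] 0ₛ x = refl
  span-[] (add p q) x = trans (+-cong (span-[] p x) (span-[] q x)) (+-identityˡ 0#)
  span-[] (scale c p) x = trans (*-congˡ (span-[] p x)) (zeroʳ c)
  span-[] (resp e p) x = trans (sym (e x)) (span-[] p x)

  span-∷ : ∀ {b : X → A} {B f} → Span (b ∷ B) f →
    ∃₂ λ c g → Span B g × ∀ x → f x ≈ c * b x + g x
  span-∷ (gen (here ≡.refl)) = 1# , _ , 0ₛ , λ x → sym (trans (+-identityʳ _) (*-identityˡ _))
  span-∷ (gen (there b∈B)) = 0# , _ , gen b∈B , λ x → sym (trans (+-congʳ (zeroˡ _)) (+-identityˡ _))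
  span-∷ 0ₛ = 0# , _ , 0ₛ , λ x → sym (trans (+-congʳ (zeroˡ _)) (+-identityˡ _))
  span-∷ (add p q) with span-∷ p | span-∷ q
  ... | c , g , g∈ , f≈ | d , h , h∈ , f′≈ = c + d , _ , add g∈ h∈ , λ x →
    trans (+-cong (f≈ x) (f′≈ x)) (Ring.combine c _ (g x) d (h x))
  span-∷ (scale d p) with span-∷ p
  ... | c , g , g∈ , f≈ = d * c , _ , scale d g∈ , λ x →
    trans (*-congˡ (f≈ x)) (Ring.rescale c _ (g x) d)
  span-∷ (resp e p) with span-∷ p
  ... | c , g , g∈ , f≈ = c , g , g∈ , λ x → trans (sym (e x)) (f≈ x)

  -- Triangular systems and dimension

  Vanish : X → (X → A) → Set
  Vanish u f = f u ≈ 0#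

  -- The values at the points `u` form a triangular matrix with nonzero diagonal. This certificate
  -- of independence survives elimination easily, because every remaining function keeps its point.
  data Echelon {X : Set} : List (X → A) → Set where
    []  : Echelon []
    _∷_ : ∀ {f fs} → (∃[ u ] ¬ Vanish u f × All (Vanish u) fs) → Echelon fs → Echelon (f ∷ fs)

  module Dimension
    (_≟_ : Decidable _≈_)
    (integral : ∀ {x y} → x * y ≈ 0# → x ≈ 0# ⊎ y ≈ 0#) where

    record Pivot {X : Set} (b : X → A) (B fs fs′ : List (X → A)) : Set where
      field
        {p g}     : X → A
        {c}       : A
        c≉0       : ¬ c ≈ 0#
        g∈B       : Span B g
        p≈        : ∀ x → p x ≈ c * b x + g x
        p-vanish  : ∀ {u} → All (Vanish u) fs → Vanish u p
        fs-length : length fs ≡ suc (length fs′)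

    record Eliminated {X : Set} (b : X → A) (B fs : List (X → A)) : Set where
      field
        fs′     : List (X → A)
        fs′∈B   : All (Span B) fs′
        echelon : Echelon fs′
        vanish  : ∀ {u} → All (Vanish u) fs → All (Vanish u) fs′
        pivot   : fs ≡ fs′ ⊎ Pivot b B fs fs′

    -- The list is treated from its end, and the first function met there with a nonzero coefficient
    -- at `b` becomes the pivot. It vanishes at the points of all functions to its left, so
    -- subtracting multiples of it there only scales the diagonal entries by `c`.
    -- Cross-multiplication avoids division: integrality suffices.
    eliminate : ∀ {b : X → A} {B fs} → All (Span (b ∷ B)) fs → Echelon fs → Eliminated b B fs
    eliminate [] [] = record
      { fs′ = [] ; fs′∈B = [] ; echelon = [] ; vanish = λ z → z ; pivot = inj₁ ≡.refl }
    eliminate {b = b} {fs = f ∷ fs} (f∈ ∷ fs∈) ((u , fu≉0 , fsu≈0) ∷ ech)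
      with span-∷ f∈ | eliminate fs∈ ech
    ... | d , h , h∈B , f≈ | record { fs′∈B = fs′∈B ; echelon = ech′ ; vanish = v ; pivot = inj₁ ≡.refl }
      with d ≟ 0#
    ... | yes d≈0 = record
      { fs′∈B   = resp (λ x → sym (trans (f≈ x) (trans (+-congʳ (trans (*-congʳ d≈0) (zeroˡ _))) (+-identityˡ _)))) h∈B ∷ fs′∈B
      ; echelon = (u , fu≉0 , fsu≈0) ∷ ech
      ; vanish  = λ z → z
      ; pivot   = inj₁ ≡.refl
      }
    ... | no d≉0 = record
      { fs′∈B   = fs′∈B
      ; echelon = ech
      ; vanish  = All.tail
      ; pivot   = inj₂ record
        { c≉0 = d≉0 ; g∈B = h∈B ; p≈ = f≈ ; p-vanish = All.head ; fs-length = ≡.refl }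
      }
    eliminate {X} {b = b} {fs = f ∷ fs} (f∈ ∷ fs∈) ((u , fu≉0 , fsu≈0) ∷ ech)
      | d , h , h∈B , f≈ | record { fs′ = fs′ ; fs′∈B = fs′∈B ; echelon = ech′ ; vanish = v ; pivot = inj₂ P } = record
      { fs′∈B   = resp (λ x → sym (trans (+-cong (*-congˡ (f≈ x)) (*-congˡ (p≈ x))) (cancel-b x)))
                    (add (scale c h∈B) (scale (- d) g∈B)) ∷ fs′∈B
      ; echelon = (u , (λ f′u≈0 → [ c≉0 , fu≉0 ]′ (integral (trans (sym (drop-p u (p-vanish fsu≈0))) f′u≈0))) , v fsu≈0) ∷ ech′
      ; vanish  = λ { {w} (fw≈0 ∷ fsw≈0) →
          trans (drop-p w (p-vanish fsw≈0)) (trans (*-congˡ fw≈0) (zeroʳ c)) ∷ v fsw≈0 }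
      ; pivot   = inj₂ record
        { c≉0 = c≉0 ; g∈B = g∈B ; p≈ = p≈ ; p-vanish = λ z → p-vanish (All.tail z)
        ; fs-length = ≡.cong suc fs-length }
      }
      where
      open Pivot P
      f′ : X → A
      f′ x = c * f x + - d * p x
      cancel-b : ∀ x → c * (d * b x + h x) + - d * (c * b x + g x) ≈ c * h x + - d * g x
      cancel-b x = trans (Ring.regroup c (b x) (g x) d (- d) (h x))
        (trans (+-congˡ (trans (*-congʳ (-‿inverseʳ d)) (zeroˡ _))) (+-identityʳ _))
      drop-p : ∀ w → Vanish w p → f′ w ≈ c * f w
      drop-p w pw≈0 = trans (+-congˡ (trans (*-congˡ pw≈0) (zeroʳ (- d)))) (+-identityʳ _)

    -- Each generator is eliminated at the cost of at most one function, and when no generator is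
    -- left, a function with a nonzero value cannot remain.
    echelon-length : ∀ {B fs : List (X → A)} → All (Span B) fs → Echelon fs → length fs ℕ.≤ length B
    echelon-length {B = []} [] [] = z≤n
    echelon-length {B = []} (f∈ ∷ _) ((u , fu≉0 , _) ∷ _) = ⊥-elim (fu≉0 (span-[] f∈ u))
    echelon-length {B = b ∷ B} fs∈ ech with eliminate fs∈ ech
    ... | record { fs′∈B = fs′∈B ; echelon = ech′ ; pivot = inj₁ ≡.refl } =
      ℕ.m≤n⇒m≤1+n (echelon-length fs′∈B ech′)
    ... | record { fs′∈B = fs′∈B ; echelon = ech′ ; pivot = inj₂ P } =
      ℕ.≤-trans (ℕ.≤-reflexive (Pivot.fs-length P)) (s≤s (echelon-length fs′∈B ech′))

  -- Tensor products of function spaces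

  infixr 6 _⊗_
  _⊗_ : List (Y → A) → List (X → A) → List (Y × X → A)
  Φ ⊗ B = cartesianProductWith (λ φ b z → φ (proj₁ z) * b (proj₂ z)) Φ B

  ⊗-span : ∀ {Φ : List (Y → A)} {B : List (X → A)} {f g} → Span Φ f → Span B g →
    Span (Φ ⊗ B) (λ z → f (proj₁ z) * g (proj₂ z))
  ⊗-span (gen φ∈Φ) (gen b∈B) = gen (∈-cartesianProductWith⁺ _ φ∈Φ b∈B)
  ⊗-span p@(gen _) 0ₛ = resp (λ z → sym (zeroʳ _)) 0ₛ
  ⊗-span p@(gen _) (add q r) = resp (λ z → sym (distribˡ _ _ _)) (add (⊗-span p q) (⊗-span p r))
  ⊗-span p@(gen _) (scale c q) = resp (λ z → Ring.*-leftComm c _ _) (scale c (⊗-span p q))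
  ⊗-span p@(gen _) (resp e q) = resp (λ z → *-congˡ (e (proj₂ z))) (⊗-span p q)
  ⊗-span 0ₛ q = resp (λ z → sym (zeroˡ _)) 0ₛ
  ⊗-span (add p q) r = resp (λ z → sym (distribʳ _ _ _)) (add (⊗-span p r) (⊗-span q r))
  ⊗-span (scale c p) q = resp (λ z → sym (*-assoc _ _ _)) (scale c (⊗-span p q))
  ⊗-span (resp e p) q = resp (λ z → *-congʳ (e (proj₁ z))) (⊗-span p q)

  -- Stands in for the additivity of degrees: products from two spaces land in a third. It is
  -- required of generators only, and `⊙-span` extends it bilinearly.
  _⊙_⊑_ : List (X → A) → List (X → A) → List (X → A) → Set
  B ⊙ C ⊑ D = ∀ {b c} → b ∈ B → c ∈ C → Span D (λ x → b x * c x)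

  ⊙-span : ∀ {B C D : List (X → A)} {f g} → B ⊙ C ⊑ D → Span B f → Span C g → Span D (λ x → f x * g x)
  ⊙-span B⊙C⊑D (gen b∈B) (gen c∈C) = B⊙C⊑D b∈B c∈C
  ⊙-span B⊙C⊑D (gen b∈B) 0ₛ = resp (λ x → sym (zeroʳ _)) 0ₛ
  ⊙-span B⊙C⊑D p@(gen _) (add q r) =
    resp (λ x → sym (distribˡ _ _ _)) (add (⊙-span B⊙C⊑D p q) (⊙-span B⊙C⊑D p r))
  ⊙-span B⊙C⊑D p@(gen _) (scale c q) =
    resp (λ x → Ring.*-leftComm c _ _) (scale c (⊙-span B⊙C⊑D p q))
  ⊙-span B⊙C⊑D p@(gen _) (resp e q) = resp (λ x → *-congˡ (e x)) (⊙-span B⊙C⊑D p q)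
  ⊙-span B⊙C⊑D 0ₛ q = resp (λ x → sym (zeroˡ _)) 0ₛ
  ⊙-span B⊙C⊑D (add p q) r =
    resp (λ x → sym (distribʳ _ _ _)) (add (⊙-span B⊙C⊑D p r) (⊙-span B⊙C⊑D q r))
  ⊙-span B⊙C⊑D (scale c p) q = resp (λ x → sym (*-assoc _ _ _)) (scale c (⊙-span B⊙C⊑D p q))
  ⊙-span B⊙C⊑D (resp e p) q = resp (λ x → *-congʳ (e x)) (⊙-span B⊙C⊑D p q)

  ⊗-⊙ : ∀ {Φ Ψ Χ : List (Y → A)} {B C D : List (X → A)} →
    Φ ⊙ Ψ ⊑ Χ → B ⊙ C ⊑ D → (Φ ⊗ B) ⊙ (Ψ ⊗ C) ⊑ (Χ ⊗ D)
  ⊗-⊙ {Φ = Φ} {Ψ} {Χ} {B} {C} ΦΨ BC f∈ g∈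
    with ∈-cartesianProductWith⁻ _ Φ B f∈ | ∈-cartesianProductWith⁻ _ Ψ C g∈
  ... | φ , b , φ∈ , b∈ , ≡.refl | ψ , c , ψ∈ , c∈ , ≡.refl =
    resp (λ z → Ring.*-interchange _ _ _ _) (⊗-span (ΦΨ φ∈ ψ∈) (BC b∈ c∈))

  -- Nested pairs over a base, so that iterating `⊗` gives functions on it directly. Configurations
  -- arise by stacking `K` lines on `n` points on `⊤`.
  Power : Set → Set → ℕ → Set
  Power Y X zero    = X
  Power Y X (suc N) = Y × Power Y X N

  base : ∀ N → Power Y X N → X
  base zero    x = x
  base (suc N) z = base N (proj₂ z)

  lookup : ∀ N → Power Y X N → Fin N → Y
  lookup (suc N) z zero    = proj₁ z
  lookup (suc N) z (suc i) = lookup N (proj₂ z) i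

  tabulate : ∀ N → (Fin N → Y) → X → Power Y X N
  tabulate zero    f x = x
  tabulate (suc N) f x = f zero , tabulate N (λ i → f (suc i)) x

  lookup-tabulate : ∀ N (f : Fin N → Y) (x : X) i → lookup N (tabulate N f x) i ≡ f i
  lookup-tabulate (suc N) f x zero    = ≡.refl
  lookup-tabulate (suc N) f x (suc i) = lookup-tabulate N (λ i → f (suc i)) x i

  infix 8 _⊗^[_]_
  _⊗^[_]_ : List (Y → A) → ∀ N → List (X → A) → List (Power Y X N → A)
  Φ ⊗^[ zero  ] B = B
  Φ ⊗^[ suc N ] B = Φ ⊗ Φ ⊗^[ N ] B

  -- A function of one coordinate is lifted to all of them by multiplying with 1 in the others, so
  -- the constants must lie in every factor.
  One : List (X → A) → Set
  One B = Span B (λ _ → 1#)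

  ⊗-one : ∀ {Φ : List (Y → A)} {B : List (X → A)} → One Φ → One B → One (Φ ⊗ B)
  ⊗-one p q = resp (λ _ → *-identityˡ 1#) (⊗-span p q)

  ⊗^-one : ∀ {Φ : List (Y → A)} {B : List (X → A)} N → One Φ → One B → One (Φ ⊗^[ N ] B)
  ⊗^-one zero    p q = q
  ⊗^-one (suc N) p q = ⊗-one p (⊗^-one N p q)

  ⊗^-base : ∀ {Φ : List (Y → A)} {B : List (X → A)} {f} N → One Φ → Span B f →
    Span (Φ ⊗^[ N ] B) (λ z → f (base N z))
  ⊗^-base zero    p q = q
  ⊗^-base (suc N) p q = resp (λ _ → *-identityˡ _) (⊗-span p (⊗^-base N p q))

  ⊗^-lookup : ∀ {Φ : List (Y → A)} {B : List (X → A)} {f} N i → One Φ → One B → Span Φ f →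
    Span (Φ ⊗^[ N ] B) (λ z → f (lookup N z i))
  ⊗^-lookup (suc N) zero    p q r = resp (λ _ → *-identityʳ _) (⊗-span r (⊗^-one N p q))
  ⊗^-lookup (suc N) (suc i) p q r = resp (λ _ → *-identityˡ _) (⊗-span p (⊗^-lookup N i p q r))

  ⊗^-⊙ : ∀ {Φ Ψ Χ : List (Y → A)} {B C D : List (X → A)} N →
    Φ ⊙ Ψ ⊑ Χ → B ⊙ C ⊑ D → (Φ ⊗^[ N ] B) ⊙ (Ψ ⊗^[ N ] C) ⊑ (Χ ⊗^[ N ] D)
  ⊗^-⊙ zero    p q = q
  ⊗^-⊙ (suc N) p q = ⊗-⊙ p (⊗^-⊙ N p q)

  length-⊗ : ∀ (Φ : List (Y → A)) (B : List (X → A)) → length (Φ ⊗ B) ≡ length Φ ℕ.* length B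
  length-⊗ []      B = ≡.refl
  length-⊗ (φ ∷ Φ) B = ≡.trans (length-++ (map _ B)) (≡.cong₂ ℕ._+_ (length-map _ B) (length-⊗ Φ B))

  length-⊗^ : ∀ (Φ : List (Y → A)) N (B : List (X → A)) →
    length (Φ ⊗^[ N ] B) ≡ length Φ ℕ.^ N ℕ.* length B
  length-⊗^ Φ zero    B = ≡.sym (ℕ.*-identityˡ _)
  length-⊗^ Φ (suc N) B = ≡.trans (length-⊗ Φ (Φ ⊗^[ N ] B))
    (≡.trans (≡.cong (length Φ ℕ.*_) (length-⊗^ Φ N B)) (≡.sym (ℕ.*-assoc (length Φ) _ _)))

  -- Polynomials on configurations

  powers : ℕ → List (A → A)
  powers d = applyUpTo (λ e x → x ^ e) (suc d)

  powers-one : ∀ d → One (powers d)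
  powers-one d = gen (here ≡.refl)

  powers-id : Span (powers 1) (λ x → x)
  powers-id = resp *-identityʳ (gen (there (here ≡.refl)))

  powers-⊙ : ∀ d d′ → powers d ⊙ powers d′ ⊑ powers (d ℕ.+ d′)
  powers-⊙ d d′ f∈ g∈ with ∈-applyUpTo⁻ (λ e x → x ^ e) f∈ | ∈-applyUpTo⁻ (λ e x → x ^ e) g∈
  ... | e , s≤s e≤d , ≡.refl | e′ , s≤s e′≤d′ , ≡.refl =
    resp (λ x → ^-homo-* x e e′) (gen (∈-applyUpTo⁺ (λ e x → x ^ e) (s≤s (ℕ.+-mono-≤ e≤d e′≤d′))))

  -- The directions of a slope set, where absent pads a set of fewer than K slopes to K directions.
  data Line : Set where
    absent vertical : Line
    slanted         : A → Line

  isAbsent isVertical : Line → A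
  isAbsent absent      = 1#
  isAbsent vertical    = 0#
  isAbsent (slanted _) = 0#
  isVertical absent      = 0#
  isVertical vertical    = 1#
  isVertical (slanted _) = 0#

  slant : (A → A) → Line → A
  slant f absent      = 0#
  slant f vertical    = 0#
  slant f (slanted a) = f a

  -- `Line` is an affine line together with two isolated points. Their indicators join the `d + 1`
  -- monomials, extended by zero; this is the origin of the 3 in the base `m + 3`.
  lines : ℕ → List (Line → A)
  lines d = isAbsent ∷ isVertical ∷ map slant (powers d)

  slant-span : ∀ {d f} → Span (powers d) f → Span (lines d) (slant f)
  slant-span (gen f∈) = gen (there (there (∈-map⁺ slant f∈)))
  slant-span 0ₛ = resp (λ { absent → refl ; vertical → refl ; (slanted _) → refl }) 0ₛ
  slant-span (add p q) = resp
    (λ { absent → +-identityˡ 0# ; vertical → +-identityˡ 0# ; (slanted _) → refl })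
    (add (slant-span p) (slant-span q))
  slant-span (scale c p) = resp
    (λ { absent → zeroʳ c ; vertical → zeroʳ c ; (slanted _) → refl }) (scale c (slant-span p))
  slant-span (resp e p) = resp
    (λ { absent → refl ; vertical → refl ; (slanted a) → e a }) (slant-span p)

  lines-one : ∀ d → One (lines d)
  lines-one d = resp
    (λ { absent → trans (+-identityʳ _) (+-identityʳ 1#)
       ; vertical → trans (+-identityʳ _) (+-identityˡ 1#)
       ; (slanted _) → trans (+-congʳ (+-identityˡ 0#)) (+-identityˡ 1#) })
    (add (add (gen (here ≡.refl)) (gen (there (here ≡.refl)))) (slant-span {d} (powers-one d)))

  -- The three components of `Line` are disjoint: indicators are idempotent, mixed products vanish,
  -- and only two slanted generators add their degrees.
  lines-⊙ : ∀ d d′ → lines d ⊙ lines d′ ⊑ lines (d ℕ.+ d′)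
  lines-⊙ d d′ (here ≡.refl) (here ≡.refl) = resp
    (λ { absent → sym (*-identityˡ 1#) ; vertical → sym (zeroˡ _) ; (slanted _) → sym (zeroˡ _) })
    (gen (here ≡.refl))
  lines-⊙ d d′ (there (here ≡.refl)) (there (here ≡.refl)) = resp
    (λ { absent → sym (zeroˡ _) ; vertical → sym (*-identityˡ 1#) ; (slanted _) → sym (zeroˡ _) })
    (gen (there (here ≡.refl)))
  lines-⊙ d d′ (here ≡.refl) (there (here ≡.refl)) = resp
    (λ { absent → sym (zeroʳ _) ; vertical → sym (zeroˡ _) ; (slanted _) → sym (zeroˡ _) }) 0ₛ
  lines-⊙ d d′ (there (here ≡.refl)) (here ≡.refl) = resp
    (λ { absent → sym (zeroˡ _) ; vertical → sym (zeroʳ _) ; (slanted _) → sym (zeroˡ _) }) 0ₛ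
  lines-⊙ d d′ (here ≡.refl) (there (there g∈)) with ∈-map⁻ slant g∈
  ... | _ , _ , ≡.refl = resp
    (λ { absent → sym (zeroʳ _) ; vertical → sym (zeroˡ _) ; (slanted _) → sym (zeroˡ _) }) 0ₛ
  lines-⊙ d d′ (there (here ≡.refl)) (there (there g∈)) with ∈-map⁻ slant g∈
  ... | _ , _ , ≡.refl = resp
    (λ { absent → sym (zeroˡ _) ; vertical → sym (zeroʳ _) ; (slanted _) → sym (zeroˡ _) }) 0ₛ
  lines-⊙ d d′ (there (there f∈)) (here ≡.refl) with ∈-map⁻ slant f∈
  ... | _ , _ , ≡.refl = resp
    (λ { absent → sym (zeroˡ _) ; vertical → sym (zeroˡ _) ; (slanted _) → sym (zeroʳ _) }) 0ₛ
  lines-⊙ d d′ (there (there f∈)) (there (here ≡.refl)) with ∈-map⁻ slant f∈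
  ... | _ , _ , ≡.refl = resp
    (λ { absent → sym (zeroˡ _) ; vertical → sym (zeroˡ _) ; (slanted _) → sym (zeroʳ _) }) 0ₛ
  lines-⊙ d d′ (there (there f∈)) (there (there g∈)) with ∈-map⁻ slant f∈ | ∈-map⁻ slant g∈
  ... | φ , φ∈ , ≡.refl | ψ , ψ∈ , ≡.refl = resp
    (λ { absent → sym (zeroˡ _) ; vertical → sym (zeroˡ _) ; (slanted _) → refl })
    (slant-span (powers-⊙ d d′ φ∈ ψ∈))

  length-lines : ∀ d → length (lines d) ≡ 3 ℕ.+ d
  length-lines d = ≡.cong (λ l → 2 ℕ.+ l)
    (≡.trans (length-map slant (powers d)) (length-applyUpTo (λ e x → x ^ e) (suc d)))

  plane : ℕ → List (A × A → A)
  plane d = powers d ⊗ powers d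

  unit : List (⊤ → A)
  unit = (λ _ → 1#) ∷ []

  Points : ℕ → Set
  Points n = Power (A × A) ⊤ n

  polys : ℕ → ∀ n → List (Points n → A)
  polys d n = plane d ⊗^[ n ] unit

  polys-one : ∀ d n → One (polys d n)
  polys-one d n = ⊗^-one n (⊗-one (powers-one d) (powers-one d)) (gen (here ≡.refl))

  unit-⊙ : unit ⊙ unit ⊑ unit
  unit-⊙ (here ≡.refl) (here ≡.refl) = resp (λ _ → sym (*-identityˡ 1#)) (gen (here ≡.refl))

  polys-⊙ : ∀ d d′ n → polys d n ⊙ polys d′ n ⊑ polys (d ℕ.+ d′) n
  polys-⊙ d d′ n = ⊗^-⊙ n (⊗-⊙ (powers-⊙ d d′) (powers-⊙ d d′)) unit-⊙

  x-coordinate : ∀ n i → Span (polys 1 n) (λ z → proj₁ (lookup n z i))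
  x-coordinate n i = ⊗^-lookup n i (⊗-one (powers-one 1) (powers-one 1)) (gen (here ≡.refl))
    (resp (λ _ → *-identityʳ _) (⊗-span powers-id (powers-one 1)))

  y-coordinate : ∀ n i → Span (polys 1 n) (λ z → proj₂ (lookup n z i))
  y-coordinate n i = ⊗^-lookup n i (⊗-one (powers-one 1) (powers-one 1)) (gen (here ≡.refl))
    (resp (λ _ → *-identityˡ _) (⊗-span (powers-one 1) powers-id))

  span-sub : ∀ {B : List (X → A)} {f g} → Span B f → Span B g → Span B (λ x → f x - g x)
  span-sub {g = g} p q = resp (λ x → +-congˡ (-1*x≈-x (g x))) (add p (scale (- 1#) q))

  Config : ℕ → ℕ → Set
  Config n K = Power Line (Points n) K

  -- Here `d` bounds the degree in each slope and `d′` the degree in each coordinate. A joint bound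
  -- would let the degree in a slope grow with `K` and spoil the constant.
  space : ℕ → ℕ → ∀ n K → List (Config n K → A)
  space d d′ n K = lines d ⊗^[ K ] polys d′ n

  space-one : ∀ d d′ n K → One (space d d′ n K)
  space-one d d′ n K = ⊗^-one K (lines-one d) (polys-one d′ n)

  space-⊙ : ∀ d d′ e e′ n K → space d e n K ⊙ space d′ e′ n K ⊑ space (d ℕ.+ d′) (e ℕ.+ e′) n K
  space-⊙ d d′ e e′ n K = ⊗^-⊙ K (lines-⊙ d d′) (polys-⊙ e e′ n)

  length-space : ∀ d d′ n K →
    length (space d d′ n K) ≡ (3 ℕ.+ d) ℕ.^ K ℕ.* (suc d′ ℕ.* suc d′) ℕ.^ n
  length-space d d′ n K = ≡.trans (length-⊗^ (lines d) K (polys d′ n)) (≡.cong₂ (λ a b → a ℕ.^ K ℕ.* b)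
    (length-lines d)
    (≡.trans (length-⊗^ (plane d′) n unit) (≡.trans (ℕ.*-identityʳ _) (≡.cong (ℕ._^ n)
      (≡.trans (length-⊗ (powers d′) (powers d′)) (≡.cong₂ ℕ._*_ length-powers length-powers))))))
    where
    length-powers : length (powers d′) ≡ suc d′
    length-powers = length-applyUpTo (λ e x → x ^ e) (suc d′)

  factor : Line → A × A → A × A → A
  factor absent      v w = 1#
  factor vertical    v w = proj₁ w - proj₁ v
  factor (slanted a) v w = (proj₂ w - proj₂ v) - a * (proj₁ w - proj₁ v)

  factor-span : ∀ n K (i j : Fin n) → Span (lines 1 ⊗ space 0 1 n K)
    (λ z → factor (proj₁ z) (lookup n (base K (proj₂ z)) i) (lookup n (base K (proj₂ z)) j))
  factor-span n K i j = resp
    (λ { (absent , z) → trans (+-cong (trans (+-cong (*-identityˡ 1#) (zeroˡ _)) (+-identityʳ 1#))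
           (sub-cong (zeroˡ _) (zeroˡ _))) (trans (+-congˡ (-‿inverseʳ 0#)) (+-identityʳ 1#))
       ; (vertical , z) → trans (+-cong (trans (+-cong (zeroˡ _) (*-identityˡ _)) (+-identityˡ _))
           (sub-cong (zeroˡ _) (zeroˡ _))) (trans (+-congˡ (-‿inverseʳ 0#)) (+-identityʳ _))
       ; (slanted a , z) → trans (+-cong (trans (+-cong (zeroˡ _) (zeroˡ _)) (+-identityʳ 0#))
           (sub-cong (*-identityˡ _) refl)) (+-identityˡ _) })
    -- One summand for each component of `Line`: 1 on `absent`, the run on `vertical`, and rise
    -- minus slope times run on `slanted`.
    (add (add (⊗-span isAbsent∈ (space-one 0 1 n K))
              (⊗-span isVertical∈ dx))
         (span-sub (⊗-span (slant-span (powers-one 1)) dy) (⊗-span (slant-span powers-id) dx)))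
    where
    sub-cong : ∀ {a b c d} → a ≈ b → c ≈ d → a - c ≈ b - d
    sub-cong p q = +-cong p (-‿cong q)
    isAbsent∈ : Span (lines 1) isAbsent
    isAbsent∈ = gen (here ≡.refl)
    isVertical∈ : Span (lines 1) isVertical
    isVertical∈ = gen (there (here ≡.refl))
    Δx Δy : Points n → A
    Δx z = proj₁ (lookup n z j) - proj₁ (lookup n z i)
    Δy z = proj₂ (lookup n z j) - proj₂ (lookup n z i)
    dx : Span (space 0 1 n K) (λ z → Δx (base K z))
    dx = ⊗^-base {f = Δx} K (lines-one 0) (span-sub (x-coordinate n j) (x-coordinate n i))
    dy : Span (space 0 1 n K) (λ z → Δy (base K z))
    dy = ⊗^-base {f = Δy} K (lines-one 0) (span-sub (y-coordinate n j) (y-coordinate n i))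

  -- Edge polynomials and their products

  edgePoly : ∀ {n} K → Fin n × Fin n → Config n K → A
  edgePoly zero    e z = 1#
  edgePoly {n} (suc K) e z =
    factor (proj₁ z) (lookup n (base K (proj₂ z)) (proj₁ e)) (lookup n (base K (proj₂ z)) (proj₂ e))
      * edgePoly K e (proj₂ z)

  -- The new factor has degree 0 in the old slopes and the old product has degree 0 in the new one,
  -- so the degree in each slope stays 1; only the coordinates are shared, and there the degrees add
  -- up to `K`.
  edgePoly-span : ∀ {n} K (e : Fin n × Fin n) → Span (space 1 K n K) (edgePoly K e)
  edgePoly-span {n} zero    e = polys-one 0 n
  edgePoly-span {n} (suc K) e = ⊙-span
    (⊗-⊙ (lines-⊙ 1 0) (space-⊙ 0 1 1 K n K))
    (factor-span n K (proj₁ e) (proj₂ e))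
    (resp (λ _ → *-identityˡ _) (⊗-span (lines-one 0) (edgePoly-span K e)))

  product : {P : Set} → (P → X → A) → List P → X → A
  product q []      x = 1#
  product q (p ∷ S) x = q p x * product q S x

  product-zero : ∀ {P : Set} (q : P → X → A) {p S x} → p ∈ S → q p x ≈ 0# → product q S x ≈ 0#
  product-zero q (here ≡.refl) e = trans (*-congʳ e) (zeroˡ _)
  product-zero q (there p∈S)   e = trans (*-congˡ (product-zero q p∈S e)) (zeroʳ _)

  -- An edge left out of `S` counts as a factor 1 with the full degrees of an edge polynomial, so
  -- the products for all subsets lie in one common space.
  product-span : ∀ {n} K es {S : List (Fin n × Fin n)} → S ∈ subsets es →
    Span (space (length es) (length es ℕ.* K) n K) (product (edgePoly K) S)
  product-span {n} K [] (here ≡.refl) = space-one 0 0 n K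
  product-span {n} K (e ∷ es) S∈ with ∈-++⁻ (subsets es) S∈
  ... | inj₁ S∈′ = resp (λ _ → *-identityˡ _) (⊙-span
    (space-⊙ 1 (length es) K (length es ℕ.* K) n K) (space-one 1 K n K) (product-span K es S∈′))
  ... | inj₂ S∈′ with ∈-map⁻ (e ∷_) S∈′
  ...   | T , T∈ , ≡.refl = ⊙-span
    (space-⊙ 1 (length es) K (length es ℕ.* K) n K) (edgePoly-span K e) (product-span K es T∈)

  -- Zero patterns

  Realised : {P : Set} → (P → X → A) → List P → List P → Set
  Realised {X} q ps S = ∃[ u ] (∀ {p} → p ∈ S → ¬ q p u ≈ 0#) × (∀ {p} → p ∈ ps → ¬ p ∈ S → q p u ≈ 0#)

  module ZeroPatterns
    (_≟_ : Decidable _≈_)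
    (1≉0 : ¬ 1# ≈ 0#)
    (integral : ∀ {x y} → x * y ≈ 0# → x ≈ 0# ⊎ y ≈ 0#) where
    open Dimension _≟_ integral

    product-nonzero : ∀ {P : Set} (q : P → X → A) {S x} →
      (∀ {p} → p ∈ S → ¬ q p x ≈ 0#) → ¬ product q S x ≈ 0#
    product-nonzero q {[]}    h e = 1≉0 e
    product-nonzero q {p ∷ S} h e with integral e
    ... | inj₁ e′ = h (here ≡.refl) e′
    ... | inj₂ e′ = product-nonzero q (λ p∈S → h (there p∈S)) e′

    -- The point realising `S` is nonzero on the product of `S` and kills that of every later `T`,
    -- because `T` contains an element outside `S`.
    products-echelon : ∀ {P : Set} (q : P → X → A) {ps L} →
      All (Realised q ps) L → AllPairs (Separated ps) L → Echelon (map (product q) L)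
    products-echelon q []                       []         = []
    products-echelon q ((u , nonzero , iszero) ∷ rs) (sep ∷ seps) =
      (u , product-nonzero q nonzero , All.map⁺ (All.map
        (λ (p , p∈ , p∈T , p∉S) → product-zero q p∈T (iszero p∈ p∉S)) sep))
      ∷ products-echelon q rs seps

    zeroPatterns-bound : ∀ {n} K {es : List (Fin n × Fin n)} → Unique es →
      (∀ {S} → S ∈ subsets es → Realised (edgePoly K) es S) →
      2 ℕ.^ length es ℕ.≤
        (3 ℕ.+ length es) ℕ.^ K ℕ.* (suc (length es ℕ.* K) ℕ.* suc (length es ℕ.* K)) ℕ.^ n
    zeroPatterns-bound {n} K {es} es! realise = ≡.subst₂ ℕ._≤_
      (≡.trans (length-map _ (subsets es)) (length-subsets es))
      (length-space (length es) (length es ℕ.* K) n K)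
      (echelon-length
        (All.map⁺ (All.tabulate (product-span K es)))
        (products-echelon (edgePoly K) (All.tabulate realise) (subsets-separated es!)))

-- Estimates

module Arithmetic where
  open import Data.Nat.Base
  open import Data.Nat.Properties
  open ≤-Reasoning
  open ℕ.+-*-Solver using (solve; _:=_; _:+_; _:*_; con)

  m<2^m : ∀ m → m < 2 ^ m
  m<2^m zero    = s≤s z≤n
  m<2^m (suc m) = begin-strict
    suc m             <⟨ s≤s (m<2^m m) ⟩
    1 + 2 ^ m         ≤⟨ +-mono-≤ (m^n>0 2 m) (≤-reflexive (≡.sym (+-identityʳ (2 ^ m)))) ⟩
    2 ^ suc m         ∎

  2^-cancel-< : ∀ {a b} → 2 ^ a < 2 ^ b → a < b
  2^-cancel-< h = ≰⇒> λ b≤a → <⇒≱ h (^-monoʳ-≤ 2 b≤a)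

  ^-cancelˡ-< : ∀ {a b} c → a ^ c < b ^ c → a < b
  ^-cancelˡ-< c h = ≰⇒> λ b≤a → <⇒≱ h (^-monoˡ-≤ c b≤a)

  binary-bracket : ∀ n → ∃[ L ] 2 ^ L ≤ suc n × suc n < 2 ^ suc L
  binary-bracket zero = 0 , s≤s z≤n , s≤s (s≤s z≤n)
  binary-bracket (suc n) with binary-bracket n
  ... | L , lower , upper with suc (suc n) <? 2 ^ suc L
  ...   | yes h = L , m≤n⇒m≤1+n lower , h
  ...   | no ¬h = suc L , ≮⇒≥ ¬h , <-≤-trans (s≤s upper) (begin
    1 + 2 ^ suc L        ≤⟨ +-mono-≤ (m^n>0 2 (suc L)) (≤-reflexive (≡.sym (+-identityʳ (2 ^ suc L)))) ⟩
    2 ^ suc (suc L)      ∎)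

  -- Induction on the excess `d` of the exponent over `4 * c`. At excess 0, squaring
  -- `2 * c + 1 ≤ 2 ^ (2 * c)` suffices; raising the exponent by one doubles the right side and at
  -- most doubles the left.
  linear≤exponential : ∀ c d → c * suc (d + 4 * c) ≤ 2 ^ (d + 4 * c)
  linear≤exponential c zero = begin
    c * suc (4 * c)                   ≤⟨ m≤m+n _ (3 * c + 1) ⟩
    c * suc (4 * c) + (3 * c + 1)     ≡⟨ square c ⟩
    suc (2 * c) * suc (2 * c)         ≤⟨ *-mono-≤ (m<2^m (2 * c)) (m<2^m (2 * c)) ⟩
    2 ^ (2 * c) * 2 ^ (2 * c)         ≡⟨ ^-distribˡ-+-* 2 (2 * c) (2 * c) ⟨
    2 ^ (2 * c + 2 * c)               ≡⟨ ≡.cong (2 ^_) (double c) ⟩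
    2 ^ (4 * c)                       ∎
    where
    square : ∀ c → c * suc (4 * c) + (3 * c + 1) ≡ suc (2 * c) * suc (2 * c)
    square = solve 1 (λ c → c :* (con 1 :+ con 4 :* c) :+ (con 3 :* c :+ con 1) :=
      (con 1 :+ con 2 :* c) :* (con 1 :+ con 2 :* c)) ≡.refl
    double : ∀ c → 2 * c + 2 * c ≡ 4 * c
    double = solve 1 (λ c → con 2 :* c :+ con 2 :* c := con 4 :* c) ≡.refl
  linear≤exponential c (suc d) = begin
    c * suc (suc e)         ≤⟨ *-monoʳ-≤ c (s≤s (s≤s (m≤m+n e (e + 0)))) ⟩
    c * (2 + 2 * e)         ≡⟨ rearrange c e ⟩
    2 * (c * suc e)         ≤⟨ *-monoʳ-≤ 2 (linear≤exponential c d) ⟩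
    2 ^ suc e               ∎
    where
    e : ℕ
    e = d + 4 * c
    rearrange : ∀ c e → c * (2 + 2 * e) ≡ 2 * (c * suc e)
    rearrange = solve 2 (λ c e → c :* (con 2 :+ con 2 :* e) := con 2 :* (c :* (con 1 :+ e))) ≡.refl

  -- With `2 ^ L ≤ n < 2 ^ (L + 1)` it suffices that `(L + 1) * c ≤ 2 ^ L`, and the threshold on `n`
  -- ensures `4 * c ≤ L`, as `linear≤exponential` demands.
  n^c≤2^n : ∀ c n → 2 ^ (4 * c) ≤ n → n ^ c ≤ 2 ^ n
  n^c≤2^n c zero    h = contradiction h (<⇒≱ (m^n>0 2 (4 * c)))
  n^c≤2^n c (suc n) h with binary-bracket n
  ... | L , lower , upper = begin
    suc n ^ c            ≤⟨ ^-monoˡ-≤ c (<⇒≤ upper) ⟩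
    (2 ^ suc L) ^ c      ≡⟨ ^-*-assoc 2 (suc L) c ⟩
    2 ^ (suc L * c)      ≤⟨ ^-monoʳ-≤ 2 exponent ⟩
    2 ^ suc n            ∎
    where
    4c≤L : 4 * c ≤ L
    4c≤L = s≤s⁻¹ (2^-cancel-< (≤-<-trans h upper))
    exponent : suc L * c ≤ suc n
    exponent = begin
      suc L * c                               ≡⟨ *-comm (suc L) c ⟩
      c * suc L                               ≡⟨ ≡.cong (λ l → c * suc l) (m∸n+n≡m 4c≤L) ⟨
      c * suc (L ∸ 4 * c + 4 * c)             ≤⟨ linear≤exponential c (L ∸ 4 * c) ⟩
      2 ^ (L ∸ 4 * c + 4 * c)                 ≡⟨ ≡.cong (2 ^_) (m∸n+n≡m 4c≤L) ⟩
      2 ^ L                                   ≤⟨ lower ⟩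
      suc n                                   ∎

  -- A crude bound, from replacing the base `n` by 2. It keeps `m * K + 1` below a fixed power of
  -- `n`, so that the coordinates do not affect the leading constant.
  K<n² : ∀ {q n K} → 2 ≤ n → n ^ (suc (4 * q) * K) < 2 ^ (q * (n * n)) → K < n * n
  K<n² {q} {n} {K} 2≤n h = ≰⇒> λ n²≤K → <⇒≱ exponents (begin
    q * (n * n)        ≤⟨ *-mono-≤ (m≤n⇒m≤1+n (m≤m+n q (3 * q))) n²≤K ⟩
    suc (4 * q) * K    ∎)
    where
    exponents : suc (4 * q) * K < q * (n * n)
    exponents = 2^-cancel-< (≤-<-trans (^-monoˡ-≤ (suc (4 * q) * K) 2≤n) h)

  -- The dimension bound, at most n ^ (2 K + 8 n), is compared with 2 ^ m after raising both to the
  -- power 2 a, where a = 4 q + 1; the extra factor 2 ^ (a n) turns 2 m + n into n².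
  dimension<2^m : ∀ {q n K m} → 2 ≤ n → 2 * m + n ≡ n * n →
    n ^ (17 * suc (4 * q)) ≤ 2 ^ n → n ^ (suc (4 * q) * K) < 2 ^ (q * (n * n)) →
    (3 + m) ^ K * (suc (m * K) * suc (m * K)) ^ n < 2 ^ m
  dimension<2^m {q} {n@(suc _)} {K} {m} 2≤n edge-count growth h =
    ≤-<-trans dimension≤ (^-cancelˡ-< (2 * a) (*-cancelʳ-< (2 ^ (a * n)) _ _ (begin-strict
      (n ^ (2 * K + 8 * n)) ^ (2 * a) * 2 ^ (a * n)      ≤⟨ *-monoʳ-≤ ((n ^ (2 * K + 8 * n)) ^ (2 * a)) (^-monoˡ-≤ (a * n) 2≤n) ⟩
      (n ^ (2 * K + 8 * n)) ^ (2 * a) * n ^ (a * n)      ≡⟨ ≡.cong (_* n ^ (a * n)) (^-*-assoc n (2 * K + 8 * n) (2 * a)) ⟩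
      n ^ ((2 * K + 8 * n) * (2 * a)) * n ^ (a * n)      ≡⟨ ^-distribˡ-+-* n ((2 * K + 8 * n) * (2 * a)) (a * n) ⟨
      n ^ ((2 * K + 8 * n) * (2 * a) + a * n)            ≡⟨ ≡.cong (n ^_) (exponents a K n) ⟩
      n ^ (a * K * 4 + 17 * a * n)                       ≡⟨ ^-distribˡ-+-* n (a * K * 4) (17 * a * n) ⟩
      n ^ (a * K * 4) * n ^ (17 * a * n)                 ≡⟨ ≡.cong₂ _*_ (^-*-assoc n (a * K) 4) (^-*-assoc n (17 * a) n) ⟨
      (n ^ (a * K)) ^ 4 * (n ^ (17 * a)) ^ n             <⟨ *-monoˡ-< _ {{m^n≢0 (n ^ (17 * a)) n {{m^n≢0 n (17 * a)}}}} (^-monoˡ-< 4 h) ⟩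
      (2 ^ (q * (n * n))) ^ 4 * (n ^ (17 * a)) ^ n       ≤⟨ *-monoʳ-≤ ((2 ^ (q * (n * n))) ^ 4) (^-monoˡ-≤ n growth) ⟩
      (2 ^ (q * (n * n))) ^ 4 * (2 ^ n) ^ n              ≡⟨ ≡.cong₂ _*_ (^-*-assoc 2 (q * (n * n)) 4) (^-*-assoc 2 n n) ⟩
      2 ^ (q * (n * n) * 4) * 2 ^ (n * n)                ≡⟨ ^-distribˡ-+-* 2 (q * (n * n) * 4) (n * n) ⟨
      2 ^ (q * (n * n) * 4 + n * n)                      ≡⟨ ≡.cong (2 ^_) (collect q (n * n)) ⟩
      2 ^ (a * (n * n))                                  ≡⟨ ≡.cong (λ s → 2 ^ (a * s)) edge-count ⟨
      2 ^ (a * (2 * m + n))                              ≡⟨ ≡.cong (2 ^_) (expand a m n) ⟩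
      2 ^ (m * (2 * a) + a * n)                          ≡⟨ ^-distribˡ-+-* 2 (m * (2 * a)) (a * n) ⟩
      2 ^ (m * (2 * a)) * 2 ^ (a * n)                    ≡⟨ ≡.cong (_* 2 ^ (a * n)) (^-*-assoc 2 m (2 * a)) ⟨
      (2 ^ m) ^ (2 * a) * 2 ^ (a * n)                    ∎)))
    where
    a : ℕ
    a = suc (4 * q)
    exponents : ∀ a K n → (2 * K + 8 * n) * (2 * a) + a * n ≡ a * K * 4 + 17 * a * n
    exponents = solve 3 (λ a K n → (con 2 :* K :+ con 8 :* n) :* (con 2 :* a) :+ a :* n :=
      a :* K :* con 4 :+ con 17 :* a :* n) ≡.refl
    collect : ∀ q s → q * s * 4 + s ≡ suc (4 * q) * s
    collect = solve 2 (λ q s → q :* s :* con 4 :+ s := (con 1 :+ con 4 :* q) :* s) ≡.refl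
    expand : ∀ a m n → a * (2 * m + n) ≡ m * (2 * a) + a * n
    expand = solve 3 (λ a m n → a :* (con 2 :* m :+ n) := m :* (con 2 :* a) :+ a :* n) ≡.refl
    n²≡n^2 : n * n ≡ n ^ 2
    n²≡n^2 = ≡.cong (n *_) (≡.sym (*-identityʳ n))
    4≤n² : 4 ≤ n * n
    4≤n² = *-mono-≤ 2≤n 2≤n
    m≤n² : m ≤ n * n
    m≤n² = begin
      m                ≤⟨ m≤m+n m (m + 0) ⟩
      2 * m            ≤⟨ m≤m+n (2 * m) n ⟩
      2 * m + n        ≡⟨ edge-count ⟩
      n * n            ∎
    3+m≤n² : 3 + m ≤ n * n
    3+m≤n² = *-cancelˡ-≤ 2 (begin
      2 * (3 + m)                ≡⟨ *-distribˡ-+ 2 3 m ⟩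
      6 + 2 * m                  ≤⟨ +-monoˡ-≤ (2 * m) (+-mono-≤ 4≤n² 2≤n) ⟩
      (n * n + n) + 2 * m        ≡⟨ rearrange (n * n) n m ⟩
      n * n + (2 * m + n)        ≡⟨ ≡.cong (λ s → n * n + s) edge-count ⟩
      n * n + n * n              ≡⟨ ≡.cong (λ s → n * n + s) (+-identityʳ (n * n)) ⟨
      2 * (n * n)                ∎)
      where
      rearrange : ∀ s n m → (s + n) + 2 * m ≡ s + (2 * m + n)
      rearrange = solve 3 (λ s n m → (s :+ n) :+ con 2 :* m := s :+ (con 2 :* m :+ n)) ≡.refl
    1+mK≤n⁴ : suc (m * K) ≤ (n * n) * (n * n)
    1+mK≤n⁴ = begin
      1 + m * K                  ≤⟨ +-mono-≤ (≤-trans (s≤s z≤n) 4≤n²) (*-monoˡ-≤ K m≤n²) ⟩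
      n * n + n * n * K          ≡⟨ *-suc (n * n) K ⟨
      n * n * suc K              ≤⟨ *-monoʳ-≤ (n * n) (K<n² {q} 2≤n h) ⟩
      (n * n) * (n * n)          ∎
    n⁸ : (n * n) * (n * n) * ((n * n) * (n * n)) ≡ n ^ 8
    n⁸ = ≡.trans (≡.cong (λ s → s * s * (s * s)) n²≡n^2)
      (≡.trans (≡.cong₂ _*_ (≡.sym (^-distribˡ-+-* n 2 2)) (≡.sym (^-distribˡ-+-* n 2 2)))
        (≡.sym (^-distribˡ-+-* n 4 4)))
    dimension≤ : (3 + m) ^ K * (suc (m * K) * suc (m * K)) ^ n ≤ n ^ (2 * K + 8 * n)
    dimension≤ = begin
      (3 + m) ^ K * (suc (m * K) * suc (m * K)) ^ n
        ≤⟨ *-mono-≤ (^-monoˡ-≤ K 3+m≤n²) (^-monoˡ-≤ n (*-mono-≤ 1+mK≤n⁴ 1+mK≤n⁴)) ⟩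
      (n * n) ^ K * ((n * n) * (n * n) * ((n * n) * (n * n))) ^ n
        ≡⟨ ≡.cong₂ (λ s t → s ^ K * t ^ n) n²≡n^2 n⁸ ⟩
      (n ^ 2) ^ K * (n ^ 8) ^ n
        ≡⟨ ≡.cong₂ _*_ (^-*-assoc n 2 K) (^-*-assoc n 8 n) ⟩
      n ^ (2 * K) * n ^ (8 * n)
        ≡⟨ ^-distribˡ-+-* n (2 * K) (8 * n) ⟨
      n ^ (2 * K + 8 * n) ∎

  -- Sums of two powers of two

  2^j≤2^i+2^j<2^[1+j] : ∀ {i j} → i < j → 2 ^ j ≤ 2 ^ i + 2 ^ j × 2 ^ i + 2 ^ j < 2 ^ suc j
  2^j≤2^i+2^j<2^[1+j] {i} {j} i<j = m≤n+m (2 ^ j) (2 ^ i) , (begin-strict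
    2 ^ i + 2 ^ j       <⟨ +-monoˡ-< (2 ^ j) (^-monoʳ-< 2 (s≤s (s≤s z≤n)) i<j) ⟩
    2 ^ j + 2 ^ j       ≡⟨ ≡.cong (λ s → 2 ^ j + s) (+-identityʳ (2 ^ j)) ⟨
    2 ^ suc j           ∎)

  2^-injective : ∀ {i j} → 2 ^ i ≡ 2 ^ j → i ≡ j
  2^-injective e = ≤-antisym
    (≮⇒≥ λ j<i → <⇒≢ (^-monoʳ-< 2 (s≤s (s≤s z≤n)) j<i) (≡.sym e))
    (≮⇒≥ λ i<j → <⇒≢ (^-monoʳ-< 2 (s≤s (s≤s z≤n)) i<j) e)

  -- The larger exponent is the position of the leading binary digit of the sum; cancelling that
  -- power leaves the smaller one.
  powers-of-2-sidon : ∀ {i j k l} → i < j → k < l → 2 ^ i + 2 ^ j ≡ 2 ^ k + 2 ^ l → i ≡ k × j ≡ l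
  powers-of-2-sidon {i} {j} {k} {l} i<j k<l e =
    2^-injective (+-cancelʳ-≡ (2 ^ j) _ _ (≡.trans e (≡.cong (λ x → 2 ^ k + 2 ^ x) (≡.sym j≡l)))) , j≡l
    where
    below : ∀ {i j k l} → i < j → k < l → 2 ^ i + 2 ^ j ≡ 2 ^ k + 2 ^ l → j ≤ l
    below {l = l} i<j k<l e = s≤s⁻¹ (2^-cancel-< (≤-<-trans (proj₁ (2^j≤2^i+2^j<2^[1+j] i<j))
      (≡.subst (_< 2 ^ suc l) (≡.sym e) (proj₂ (2^j≤2^i+2^j<2^[1+j] k<l)))))
    j≡l : j ≡ l
    j≡l = ≤-antisym (below i<j k<l e) (below k<l i<j (≡.sym e))

-- Natural numbers among the rationals

ι : ℕ → ℚ
ι n = + n ℚ./ 1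

toℚᵘ-/ : ∀ n d → ℚ.toℚᵘ (+ n ℚ./ suc d) ℚᵘ.≃ mkℚᵘ (+ n) d
toℚᵘ-/ n d = ℚ.toℚᵘ-fromℚᵘ (mkℚᵘ (+ n) d)

ι-+ : ∀ m n → ι (m ℕ.+ n) ≡ ι m ℚ.+ ι n
ι-+ m n = ℚ.toℚᵘ-injective (ℚᵘ.≃-trans (toℚᵘ-/ (m ℕ.+ n) 0) (ℚᵘ.≃-trans
  (ℚᵘ.*≡* (≡.cong (ℤ._* + 1) (≡.sym (≡.cong₂ ℤ._+_ (ℤ.*-identityʳ (+ m)) (ℤ.*-identityʳ (+ n))))))
  (ℚᵘ.≃-sym (ℚᵘ.≃-trans (ℚ.toℚᵘ-homo-+ (ι m) (ι n)) (ℚᵘ.+-cong (toℚᵘ-/ m 0) (toℚᵘ-/ n 0))))))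

/-*-/1 : ∀ m d → (+ m ℚ./ suc d) ℚ.* ι (suc d) ≡ ι m
/-*-/1 m d = ℚ.toℚᵘ-injective (ℚᵘ.≃-trans
  (ℚᵘ.≃-trans (ℚ.toℚᵘ-homo-* (+ m ℚ./ suc d) (ι (suc d))) (ℚᵘ.*-cong (toℚᵘ-/ m d) (toℚᵘ-/ (suc d) 0)))
  (ℚᵘ.≃-trans
    (ℚᵘ.*≡* (≡.trans (ℤ.*-identityʳ (+ m ℤ.* + suc d)) (≡.cong (λ e → + m ℤ.* + suc e) (≡.sym (ℕ.*-identityʳ d)))))
    (ℚᵘ.≃-sym (toℚᵘ-/ m 0))))

ι-* : ∀ m n → ι (m ℕ.* n) ≡ ι m ℚ.* ι n
ι-* m n = ℚ.toℚᵘ-injective (ℚᵘ.≃-trans (toℚᵘ-/ (m ℕ.* n) 0) (ℚᵘ.≃-trans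
  (ℚᵘ.*≡* (≡.cong (ℤ._* + 1) (ℤ.pos-* m n)))
  (ℚᵘ.≃-sym (ℚᵘ.≃-trans (ℚ.toℚᵘ-homo-* (ι m) (ι n)) (ℚᵘ.*-cong (toℚᵘ-/ m 0) (toℚᵘ-/ n 0))))))

ι-mono-≤ : ∀ {m n} → m ℕ.≤ n → ι m ℚ.≤ ι n
ι-mono-≤ {m} {n} m≤n = ℚ.toℚᵘ-cancel-≤ (ℚᵘ.≤-respˡ-≃ (ℚᵘ.≃-sym (toℚᵘ-/ m 0))
  (ℚᵘ.≤-respʳ-≃ (ℚᵘ.≃-sym (toℚᵘ-/ n 0)) (ℚᵘ.*≤* (ℤ.*-monoʳ-≤-nonNeg (+ 1) (ℤ.+≤+ m≤n)))))

ι-injective : ∀ {m n} → ι m ≡ ι n → m ≡ n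
ι-injective {m} {n} e with ℚᵘ.≃-trans (ℚᵘ.≃-sym (toℚᵘ-/ m 0)) (ℚᵘ.≃-trans (ℚᵘ.≃-reflexive (≡.cong ℚ.toℚᵘ e)) (toℚᵘ-/ n 0))
... | ℚᵘ.*≡* e′ = ℤ.+-injective (ℤ.*-cancelʳ-≡ (+ m) (+ n) (+ 1) e′)

ι-nonNeg : ∀ n → ℚ.NonNegative (ι n)
ι-nonNeg n = ℚ.nonNegative (ι-mono-≤ {0} {n} z≤n)

*-cancelʳ : ∀ {p q r} → r ≢ 0ℚ → p ℚ.* r ≡ q ℚ.* r → p ≡ q
*-cancelʳ {p} {q} {r} r≢0 e = ≡.trans (≡.sym (undo p)) (≡.trans (≡.cong (ℚ._* ℚ.1/ r) e) (undo q))
  where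
  instance
    r-nonZero : ℚ.NonZero r
    r-nonZero = ℚ.≢-nonZero r≢0
  undo : ∀ p → p ℚ.* r ℚ.* ℚ.1/ r ≡ p
  undo p = ≡.trans (ℚ.*-assoc p r (ℚ.1/ r))
    (≡.trans (≡.cong (p ℚ.*_) (ℚ.*-inverseʳ r)) (ℚ.*-identityʳ p))

-- The denominator of `δ` serves as `q`, since the product is then the positive numerator.
archimedean : ∀ {δ} → 0ℚ ℚ.< δ → ∃[ q ] 1ℚ ℚ.≤ ι q ℚ.* δ
archimedean {ℚ.mkℚ (+ suc p) d c} _ = suc d , ≡.subst (1ℚ ℚ.≤_)
  (≡.trans (≡.sym (/-*-/1 (suc p) d)) (≡.trans (ℚ.*-comm _ (ι (suc d)))
    (≡.cong (ι (suc d) ℚ.*_) (ℚ.fromℚᵘ-toℚᵘ (ℚ.mkℚ (+ suc p) d c)))))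
  (ι-mono-≤ {1} {suc p} (s≤s z≤n))
archimedean {ℚ.mkℚ (+ zero) d c} (ℚ.*<* (ℤ.+<+ ()))
archimedean {ℚ.mkℚ ℤ.-[1+ p ] d c} (ℚ.*<* ())

module Rational where
  open import Data.Rational.Base
  open import Data.Rational.Properties
  open ≤-Reasoning
  open ℚ.+-*-Solver using (solve; _:=_; _:+_; _:*_; con)

  -- The hypothesis in natural numbers is a (4 + 1 / q) k (s + 1 / ℓ) ≥ n², where s = F / ℓ.
  no-gap : ∀ {n k q q′ F ℓ : ℕ} {ε s δ δ′} →
    s * ι ℓ ≡ ι F → 1ℚ ≤ ι q * δ → δ ≤ ε → 1 ℕ.≤ q → 0ℚ ≤ δ′ → 1ℚ ≤ ι q′ * δ′ →
    q ℕ.* (n ℕ.* n) ℕ.* ℓ ℕ.≤ suc F ℕ.* (suc (4 ℕ.* q) ℕ.* k) →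
    suc (suc (4 ℕ.* q) ℕ.* k) ℕ.* q′ ℕ.≤ ℓ →
    ¬ ι k * ((ι 4 + ε) * s) + δ′ ≤ ι n * ι n
  no-gap {n} {k} {q} {q′} {F} {ℓ} {ε} {s} {δ} {δ′} sℓ≡F 1≤qδ δ≤ε 1≤q 0≤δ′ 1≤q′δ′ bound large h =
    <-irrefl ≡.refl (begin-strict
      ι F * M + M
        <⟨ +-monoʳ-< (ι F * M) M<1+M ⟩
      ι F * M + (1ℚ + M)
        ≤⟨ +-mono-≤ FM≤ 1+M≤ ⟩
      ι q * (ι k * ((ι 4 + ε) * s)) * ι ℓ + ι q * δ′ * ι ℓ
        ≡⟨ collect (ι q) (ι k * ((ι 4 + ε) * s)) δ′ (ι ℓ) ⟩
      ι q * (ι k * ((ι 4 + ε) * s) + δ′) * ι ℓ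
        ≤⟨ *-monoʳ-≤-nonNeg (ι ℓ) {{ι-nonNeg ℓ}} (*-monoˡ-≤-nonNeg (ι q) {{ι-nonNeg q}} h) ⟩
      ι q * (ι n * ι n) * ι ℓ
        ≡⟨ ≡.trans (ι-* (q ℕ.* (n ℕ.* n)) ℓ) (≡.cong (_* ι ℓ)
             (≡.trans (ι-* q (n ℕ.* n)) (≡.cong (ι q *_) (ι-* n n)))) ⟨
      ι (q ℕ.* (n ℕ.* n) ℕ.* ℓ)
        ≤⟨ ι-mono-≤ (ℕ.≤-trans bound (ℕ.≤-reflexive (ℕ.+-comm M′ (F ℕ.* M′)))) ⟩
      ι (F ℕ.* M′ ℕ.+ M′)
        ≡⟨ ≡.trans (ι-+ (F ℕ.* M′) M′) (≡.cong (_+ M) (ι-* F M′)) ⟩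
      ι F * M + M ∎)
    where
    M′ : ℕ
    M′ = suc (4 ℕ.* q) ℕ.* k
    M : ℚ
    M = ι M′
    collect : ∀ q x d l → q * x * l + q * d * l ≡ q * (x + d) * l
    collect = solve 4 (λ q x d l → q :* x :* l :+ q :* d :* l := q :* (x :+ d) :* l) ≡.refl
    M<1+M : M < 1ℚ + M
    M<1+M = ≡.subst (_< 1ℚ + M) (+-identityˡ M) (+-monoˡ-< M (positive⁻¹ 1ℚ))
    4q+1≤ : ι (suc (4 ℕ.* q)) ≤ ι q * (ι 4 + ε)
    4q+1≤ = begin
      ι (1 ℕ.+ 4 ℕ.* q)             ≡⟨ ≡.trans (ι-+ 1 (4 ℕ.* q)) (≡.cong (λ r → 1ℚ + r) (ι-* 4 q)) ⟩
      1ℚ + ι 4 * ι q                ≤⟨ +-monoˡ-≤ (ι 4 * ι q) (≤-trans 1≤qδ (*-monoˡ-≤-nonNeg (ι q) {{ι-nonNeg q}} δ≤ε)) ⟩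
      ι q * ε + ι 4 * ι q           ≡⟨ rearrange (ι q) ε (ι 4) ⟩
      ι q * (ι 4 + ε)               ∎
      where
      rearrange : ∀ q e f → q * e + f * q ≡ q * (f + e)
      rearrange = solve 3 (λ q e f → q :* e :+ f :* q := q :* (f :+ e)) ≡.refl
    FM≤ : ι F * M ≤ ι q * (ι k * ((ι 4 + ε) * s)) * ι ℓ
    FM≤ = begin
      ι F * M                                      ≡⟨ ≡.cong (ι F *_) (ι-* (suc (4 ℕ.* q)) k) ⟩
      ι F * (ι (suc (4 ℕ.* q)) * ι k)              ≤⟨ *-monoˡ-≤-nonNeg (ι F) {{ι-nonNeg F}} (*-monoʳ-≤-nonNeg (ι k) {{ι-nonNeg k}} 4q+1≤) ⟩
      ι F * (ι q * (ι 4 + ε) * ι k)                ≡⟨ ≡.cong (_* (ι q * (ι 4 + ε) * ι k)) sℓ≡F ⟨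
      s * ι ℓ * (ι q * (ι 4 + ε) * ι k)            ≡⟨ rearrange s (ι ℓ) (ι q) (ι 4 + ε) (ι k) ⟩
      ι q * (ι k * ((ι 4 + ε) * s)) * ι ℓ          ∎
      where
      rearrange : ∀ s l q e k → s * l * (q * e * k) ≡ q * (k * (e * s)) * l
      rearrange = solve 5 (λ s l q e k → s :* l :* (q :* e :* k) := q :* (k :* (e :* s)) :* l) ≡.refl
    1+M≤ : 1ℚ + M ≤ ι q * δ′ * ι ℓ
    1+M≤ = begin
      1ℚ + M                       ≡⟨ ι-+ 1 M′ ⟨
      ι (suc M′)                   ≡⟨ *-identityʳ (ι (suc M′)) ⟨
      ι (suc M′) * 1ℚ              ≤⟨ *-monoˡ-≤-nonNeg (ι (suc M′)) {{ι-nonNeg (suc M′)}} 1≤q′δ′ ⟩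
      ι (suc M′) * (ι q′ * δ′)     ≡⟨ *-assoc (ι (suc M′)) (ι q′) δ′ ⟨
      ι (suc M′) * ι q′ * δ′       ≡⟨ ≡.cong (_* δ′) (ι-* (suc M′) q′) ⟨
      ι (suc M′ ℕ.* q′) * δ′       ≤⟨ *-monoʳ-≤-nonNeg δ′ {{nonNegative 0≤δ′}} (ι-mono-≤ large) ⟩
      ι ℓ * δ′                     ≡⟨ ≡.cong (_* δ′) (*-identityˡ (ι ℓ)) ⟨
      1ℚ * ι ℓ * δ′                ≤⟨ *-monoʳ-≤-nonNeg δ′ {{nonNegative 0≤δ′}} (*-monoʳ-≤-nonNeg (ι ℓ) {{ι-nonNeg ℓ}} (ι-mono-≤ {1} {q} 1≤q)) ⟩
      ι q * ι ℓ * δ′               ≡⟨ swap (ι q) (ι ℓ) δ′ ⟩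
      ι q * δ′ * ι ℓ               ∎
      where
      swap : ∀ q l d → q * l * d ≡ q * d * l
      swap = solve 3 (λ q l d → q :* l :* d := q :* d :* l) ≡.refl

-- Real numbers

open import Defs
open import Algebra.Properties.Group ℚ.+-0-group using (x∙y⁻¹≈ε⇒x≈y)
open Arithmetic
open Rational

open ℚ.+-*-Solver using (solve; _:=_; _:+_; _:*_; _:-_; :-_; con)

-- Defs._≈_ unfolds to a Π-type, from which its arguments cannot be inferred.
infix 4 _≋_
record _≋_ (x y : ℝ) : Set where
  constructor ⟦_⟧
  field
    unwrap : x ≈ y
open _≋_

≡⇒≋ : ∀ {x y} → (∀ n → seq x n ≡ seq y n) → x ≋ y
≡⇒≋ {x} {y} eq = ⟦ (λ δ 0<δ → 0 , λ {n} _ → ≡.subst (ℚ._< δ)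
  (≡.sym (≡.cong ℚ.∣_∣ (≡.trans (≡.cong (λ p → p ℚ.- seq y n) (eq n)) (ℚ.+-inverseʳ (seq y n))))) 0<δ) ⟧

0<½*p : ∀ {p} → 0ℚ ℚ.< p → 0ℚ ℚ.< ½ ℚ.* p
0<½*p {p} 0<p = ≡.subst (ℚ._< ½ ℚ.* p) (ℚ.*-zeroʳ ½) (ℚ.*-monoʳ-<-pos ½ 0<p)

½p+½p≡p : ∀ p → ½ ℚ.* p ℚ.+ ½ ℚ.* p ≡ p
½p+½p≡p p = ≡.trans (≡.sym (ℚ.*-distribʳ-+ p ½ ½)) (ℚ.*-identityˡ p)

infixl 6 _⊕_
infixl 7 _⊛_
infix  8 ⊖_

-- Opaque, so that sums and products are compared by their arguments and not by their sequences.
opaque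
  _⊕_ _⊛_ : ℝ → ℝ → ℝ
  _⊕_ = _+_
  _⊛_ = _*_

  ⊖_ : ℝ → ℝ
  ⊖_ = -_

module _ where
  open ℚ.≤-Reasoning

  ≋-refl : ∀ {x} → x ≋ x
  ≋-refl = ≡⇒≋ λ _ → ≡.refl

  ≋-sym : ∀ {x y} → x ≋ y → y ≋ x
  ≋-sym {x} {y} ⟦ x≈y ⟧ = ⟦ (λ δ 0<δ → let N , close = x≈y δ 0<δ in N , λ {n} N≤n →
    ≡.subst (ℚ._< δ)
      (≡.trans (≡.sym (ℚ.∣-p∣≡∣p∣ (seq x n ℚ.- seq y n))) (≡.cong ℚ.∣_∣ (neg-sub (seq x n) (seq y n))))
      (close N≤n)) ⟧
    where
    neg-sub : ∀ a b → ℚ.- (a ℚ.- b) ≡ b ℚ.- a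
    neg-sub = solve 2 (λ a b → :- (a :- b) := b :- a) ≡.refl

  private
    add-close : ∀ {p q r δ} → p ≡ q ℚ.+ r →
      ℚ.∣ q ∣ ℚ.< ½ ℚ.* δ → ℚ.∣ r ∣ ℚ.< ½ ℚ.* δ → ℚ.∣ p ∣ ℚ.< δ
    add-close {p} {q} {r} {δ} eq q< r< = begin-strict
      ℚ.∣ p ∣                 ≡⟨ ≡.cong ℚ.∣_∣ eq ⟩
      ℚ.∣ q ℚ.+ r ∣           ≤⟨ ℚ.∣p+q∣≤∣p∣+∣q∣ q r ⟩
      ℚ.∣ q ∣ ℚ.+ ℚ.∣ r ∣     <⟨ ℚ.+-mono-< q< r< ⟩
      ½ ℚ.* δ ℚ.+ ½ ℚ.* δ     ≡⟨ ½p+½p≡p δ ⟩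
      δ                       ∎

  ≋-trans : ∀ {x y z} → x ≋ y → y ≋ z → x ≋ z
  ≋-trans {x} {y} {z} ⟦ x≈y ⟧ ⟦ y≈z ⟧ = ⟦ (λ δ 0<δ →
    let N₁ , close₁ = x≈y (½ ℚ.* δ) (0<½*p 0<δ)
        N₂ , close₂ = y≈z (½ ℚ.* δ) (0<½*p 0<δ)
    in N₁ ℕ.⊔ N₂ , λ {n} N≤n → add-close
         (split (seq x n) (seq y n) (seq z n))
         (close₁ (ℕ.m⊔n≤o⇒m≤o N₁ N₂ N≤n)) (close₂ (ℕ.m⊔n≤o⇒n≤o N₁ N₂ N≤n))) ⟧
    where
    split : ∀ a b c → a ℚ.- c ≡ (a ℚ.- b) ℚ.+ (b ℚ.- c)
    split = solve 3 (λ a b c → a :- c := (a :- b) :+ (b :- c)) ≡.refl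

  bounded : ∀ x → ∃[ B ] 0ℚ ℚ.< B × ∃[ N ] ∀ {n} → N ℕ.≤ n → ℚ.∣ seq x n ∣ ℚ.≤ B
  bounded x =
    let N , close = cauchy x 1ℚ (ℚ.positive⁻¹ 1ℚ)
    in ℚ.∣ seq x N ∣ ℚ.+ 1ℚ
     , ℚ.+-mono-≤-< (ℚ.0≤∣p∣ (seq x N)) (ℚ.positive⁻¹ 1ℚ)
     , N , λ {n} N≤n → begin
       ℚ.∣ seq x n ∣                                 ≡⟨ ≡.cong ℚ.∣_∣ (split (seq x n) (seq x N)) ⟩
       ℚ.∣ seq x N ℚ.+ (seq x n ℚ.- seq x N) ∣       ≤⟨ ℚ.∣p+q∣≤∣p∣+∣q∣ (seq x N) _ ⟩
       ℚ.∣ seq x N ∣ ℚ.+ ℚ.∣ seq x n ℚ.- seq x N ∣   ≤⟨ ℚ.+-monoʳ-≤ ℚ.∣ seq x N ∣ (ℚ.<⇒≤ (close N≤n ℕ.≤-refl)) ⟩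
       ℚ.∣ seq x N ∣ ℚ.+ 1ℚ                          ∎
    where
    split : ∀ a b → a ≡ b ℚ.+ (a ℚ.- b)
    split = solve 2 (λ a b → a := b :+ (a :- b)) ≡.refl

  divide : ∀ {B δ} → 0ℚ ℚ.< B → 0ℚ ℚ.< δ → ∃[ η ] 0ℚ ℚ.< η × B ℚ.* η ≡ δ
  divide {B} {δ} 0<B 0<δ = η , 0<η , Bη≡δ
    where
    instance
      B-pos : ℚ.Positive B
      B-pos = ℚ.positive 0<B
      B-nonZero : ℚ.NonZero B
      B-nonZero = ℚ.pos⇒nonZero B
    η : ℚ
    η = ℚ.1/ B ℚ.* δ
    0<η : 0ℚ ℚ.< η
    0<η = ≡.subst (ℚ._< η) (ℚ.*-zeroʳ (ℚ.1/ B))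
      (ℚ.*-monoʳ-<-pos (ℚ.1/ B) {{ℚ.1/pos⇒pos B}} 0<δ)
    Bη≡δ : B ℚ.* η ≡ δ
    Bη≡δ = ≡.trans (≡.sym (ℚ.*-assoc B (ℚ.1/ B) δ))
      (≡.trans (≡.cong (ℚ._* δ) (ℚ.*-inverseʳ B)) (ℚ.*-identityˡ δ))

  ∣p*q∣<B*η : ∀ {p q B η} → 0ℚ ℚ.< B →
    ℚ.∣ p ∣ ℚ.≤ B → ℚ.∣ q ∣ ℚ.< η → ℚ.∣ p ℚ.* q ∣ ℚ.< B ℚ.* η
  ∣p*q∣<B*η {p} {q} {B} {η} 0<B p≤B q<η = begin-strict
    ℚ.∣ p ℚ.* q ∣         ≡⟨ ℚ.∣p*q∣≡∣p∣*∣q∣ p q ⟩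
    ℚ.∣ p ∣ ℚ.* ℚ.∣ q ∣   ≤⟨ ℚ.*-monoʳ-≤-nonNeg ℚ.∣ q ∣ {{ℚ.∣-∣-nonNeg q}} p≤B ⟩
    B ℚ.* ℚ.∣ q ∣         <⟨ ℚ.*-monoʳ-<-pos B {{ℚ.positive 0<B}} q<η ⟩
    B ℚ.* η               ∎

  opaque
    unfolding _⊕_

    ⊕-cong : ∀ {x y u v} → x ≋ y → u ≋ v → x ⊕ u ≋ y ⊕ v
    ⊕-cong {x} {y} {u} {v} ⟦ x≈y ⟧ ⟦ u≈v ⟧ = ⟦ (λ δ 0<δ →
      let N₁ , close₁ = x≈y (½ ℚ.* δ) (0<½*p 0<δ)
          N₂ , close₂ = u≈v (½ ℚ.* δ) (0<½*p 0<δ)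
      in N₁ ℕ.⊔ N₂ , λ {n} N≤n → add-close
           (split (seq x n) (seq u n) (seq y n) (seq v n))
           (close₁ (ℕ.m⊔n≤o⇒m≤o N₁ N₂ N≤n)) (close₂ (ℕ.m⊔n≤o⇒n≤o N₁ N₂ N≤n))) ⟧
      where
      split : ∀ a b c d → (a ℚ.+ b) ℚ.- (c ℚ.+ d) ≡ (a ℚ.- c) ℚ.+ (b ℚ.- d)
      split = solve 4 (λ a b c d → (a :+ b) :- (c :+ d) := (a :- c) :+ (b :- d)) ≡.refl

    ⊖-cong : ∀ {x y} → x ≋ y → ⊖ x ≋ ⊖ y
    ⊖-cong {x} {y} ⟦ x≈y ⟧ = ⟦ (λ δ 0<δ → let N , close = x≈y δ 0<δ in N , λ {n} N≤n →
      ≡.subst (ℚ._< δ)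
        (≡.trans (≡.sym (ℚ.∣-p∣≡∣p∣ (seq x n ℚ.- seq y n))) (≡.cong ℚ.∣_∣ (neg-sub (seq x n) (seq y n))))
        (close N≤n)) ⟧
      where
      neg-sub : ∀ a b → ℚ.- (a ℚ.- b) ≡ (ℚ.- a) ℚ.- (ℚ.- b)
      neg-sub = solve 2 (λ a b → :- (a :- b) := (:- a) :- (:- b)) ≡.refl

    ⊛-congˡ : ∀ x {y z} → y ≋ z → x ⊛ y ≋ x ⊛ z
    ⊛-congˡ x {y} {z} ⟦ y≈z ⟧ = ⟦ close ⟧
      where
      factor : ∀ a b c → a ℚ.* b ℚ.- a ℚ.* c ≡ a ℚ.* (b ℚ.- c)
      factor = solve 3 (λ a b c → a :* b :- a :* c := a :* (b :- c)) ≡.refl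
      close : x ⊛ y ≈ x ⊛ z
      close δ 0<δ =
        let B , 0<B , N₁ , bound = bounded x
            η , 0<η , Bη≡δ = divide 0<B 0<δ
            N₂ , close′ = y≈z η 0<η
        in N₁ ℕ.⊔ N₂ , λ {n} N≤n → ≡.subst₂ ℚ._<_
          (≡.cong ℚ.∣_∣ (≡.sym (factor (seq x n) (seq y n) (seq z n)))) Bη≡δ
          (∣p*q∣<B*η {p = seq x n} 0<B
            (bound (ℕ.m⊔n≤o⇒m≤o N₁ N₂ N≤n)) (close′ (ℕ.m⊔n≤o⇒n≤o N₁ N₂ N≤n)))

    ⊕-assoc : ∀ x y z → (x ⊕ y) ⊕ z ≋ x ⊕ (y ⊕ z)
    ⊕-assoc x y z = ≡⇒≋ {(x ⊕ y) ⊕ z} {x ⊕ (y ⊕ z)} λ n → ℚ.+-assoc (seq x n) (seq y n) (seq z n)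

    ⊕-comm : ∀ x y → x ⊕ y ≋ y ⊕ x
    ⊕-comm x y = ≡⇒≋ {x ⊕ y} {y ⊕ x} λ n → ℚ.+-comm (seq x n) (seq y n)

    ⊕-identityʳ : ∀ x → x ⊕ 0ℝ ≋ x
    ⊕-identityʳ x = ≡⇒≋ {x ⊕ 0ℝ} {x} λ n → ℚ.+-identityʳ (seq x n)

    ⊖-inverseʳ : ∀ x → x ⊕ ⊖ x ≋ 0ℝ
    ⊖-inverseʳ x = ≡⇒≋ {x ⊕ ⊖ x} {0ℝ} λ n → ℚ.+-inverseʳ (seq x n)

    ⊛-assoc : ∀ x y z → (x ⊛ y) ⊛ z ≋ x ⊛ (y ⊛ z)
    ⊛-assoc x y z = ≡⇒≋ {(x ⊛ y) ⊛ z} {x ⊛ (y ⊛ z)} λ n → ℚ.*-assoc (seq x n) (seq y n) (seq z n)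

    ⊛-comm : ∀ x y → x ⊛ y ≋ y ⊛ x
    ⊛-comm x y = ≡⇒≋ {x ⊛ y} {y ⊛ x} λ n → ℚ.*-comm (seq x n) (seq y n)

    ⊛-identityʳ : ∀ x → x ⊛ fromℚ 1ℚ ≋ x
    ⊛-identityʳ x = ≡⇒≋ {x ⊛ fromℚ 1ℚ} {x} λ n → ℚ.*-identityʳ (seq x n)

    ⊛-distribˡ-⊕ : ∀ x y z → x ⊛ (y ⊕ z) ≋ x ⊛ y ⊕ x ⊛ z
    ⊛-distribˡ-⊕ x y z = ≡⇒≋ {x ⊛ (y ⊕ z)} {x ⊛ y ⊕ x ⊛ z} λ n →
      ℚ.*-distribˡ-+ (seq x n) (seq y n) (seq z n)

⊛-cong : ∀ {x y u v} → x ≋ y → u ≋ v → x ⊛ u ≋ y ⊛ v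
⊛-cong {x} {y} {u} {v} x≋y u≋v = ≋-trans (⊛-congˡ x u≋v)
  (≋-trans (⊛-comm x v) (≋-trans (⊛-congˡ v x≋y) (⊛-comm v y)))

≋-setoid : Setoid 0ℓ 0ℓ
≋-setoid = record { Carrier = ℝ ; _≈_ = _≋_ ; isEquivalence = record { refl = ≋-refl ; sym = ≋-sym ; trans = ≋-trans } }

open import Algebra.Consequences.Setoid ≋-setoid using (comm∧idʳ⇒id; comm∧invʳ⇒inv; comm∧distrˡ⇒distr)

ℝ-commutativeRing : CommutativeRing 0ℓ 0ℓ
ℝ-commutativeRing = record
  { Carrier = ℝ ; _≈_ = _≋_ ; _+_ = _⊕_ ; _*_ = _⊛_ ; -_ = ⊖_ ; 0# = 0ℝ ; 1# = fromℚ 1ℚ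
  ; isCommutativeRing = record
    { isRing = record
      { +-isAbelianGroup = record
        { isGroup = record
          { isMonoid = record
            { isSemigroup = record
              { isMagma = record { isEquivalence = Setoid.isEquivalence ≋-setoid ; ∙-cong = ⊕-cong }
              ; assoc = ⊕-assoc
              }
            ; identity = comm∧idʳ⇒id ⊕-comm ⊕-identityʳ
            }
          ; inverse = comm∧invʳ⇒inv ⊕-comm ⊖-inverseʳ
          ; ⁻¹-cong = ⊖-cong
          }
        ; comm = ⊕-comm
        }
      ; *-cong = ⊛-cong
      ; *-assoc = ⊛-assoc
      ; *-identity = comm∧idʳ⇒id ⊛-comm ⊛-identityʳ
      ; distrib = comm∧distrˡ⇒distr ⊕-cong ⊛-comm ⊛-distribˡ-⊕
      }
    ; *-comm = ⊛-comm
    }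
  }

fromℚ-injective : ∀ {p q} → fromℚ p ≋ fromℚ q → p ≡ q
fromℚ-injective {p} {q} ⟦ p≈q ⟧ with p ℚ.≟ q
... | yes p≡q = p≡q
... | no  p≢q =
  let N , close = p≈q ℚ.∣ p ℚ.- q ∣ (ℚ.≰⇒> λ ∣p-q∣≤0 → p≢q (x∙y⁻¹≈ε⇒x≈y p q
        (ℚ.∣p∣≡0⇒p≡0 (p ℚ.- q) (ℚ.≤-antisym ∣p-q∣≤0 (ℚ.0≤∣p∣ (p ℚ.- q))))))
  in contradiction (close {N} ℕ.≤-refl) (ℚ.<-irrefl ≡.refl)

-- The real numbers as an integral domain

module Classical (em : ExcludedMiddle 0ℓ) where

  _≋?_ : ∀ x y → Dec (x ≋ y)
  x ≋? y = em

  dne : {P : Set} → ¬ ¬ P → P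
  dne = em⇒dne em

  -- A single late term of absolute value at least `δ` keeps the whole tail above half of `δ`, by
  -- the Cauchy property. If no tail stays away from zero, all late terms are thus below `δ`, for
  -- every `δ`.
  away-from-zero : ∀ {x} → ¬ x ≋ 0ℝ → ∃[ c ] 0ℚ ℚ.< c × ∃[ N ] ∀ {n} → N ℕ.≤ n → c ℚ.≤ ℚ.∣ seq x n ∣
  away-from-zero {x} x≉0 = dne λ near → x≉0 ⟦ (λ δ 0<δ →
    let N , close = cauchy x (½ ℚ.* δ) (0<½*p 0<δ)
    in N , λ {n} N≤n → ℚ.≰⇒> λ δ≤∣xₙ-0∣ → near (½ ℚ.* δ , 0<½*p 0<δ , N , λ {m} N≤m →
      ℚ.≮⇒≥ λ xₘ<½δ → ℚ.<-irrefl ≡.refl (begin-strict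
        δ                                                 ≤⟨ δ≤∣xₙ-0∣ ⟩
        ℚ.∣ seq x n ℚ.- 0ℚ ∣                              ≡⟨ ≡.cong ℚ.∣_∣ (split (seq x n) (seq x m)) ⟩
        ℚ.∣ seq x m ℚ.+ (seq x n ℚ.- seq x m) ∣           ≤⟨ ℚ.∣p+q∣≤∣p∣+∣q∣ (seq x m) _ ⟩
        ℚ.∣ seq x m ∣ ℚ.+ ℚ.∣ seq x n ℚ.- seq x m ∣       <⟨ ℚ.+-mono-< xₘ<½δ (close N≤n N≤m) ⟩
        ½ ℚ.* δ ℚ.+ ½ ℚ.* δ                               ≡⟨ ½p+½p≡p δ ⟩
        δ                                                 ∎))) ⟧
    where
    open ℚ.≤-Reasoning
    split : ∀ a b → a ℚ.- 0ℚ ≡ b ℚ.+ (a ℚ.- b)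
    split = solve 2 (λ a b → a :- con 0ℚ := b :+ (a :- b)) ≡.refl

  opaque
    unfolding _⊕_

    -- Eventually `x` is at least some positive `c` in absolute value, so a product below `c * δ`
    -- forces `y` below `δ`.
    zero-divisor : ∀ {x y} → x ⊛ y ≋ 0ℝ → ¬ x ≋ 0ℝ → y ≋ 0ℝ
    zero-divisor {x} {y} ⟦ xy≈0 ⟧ x≉0 = ⟦ (λ δ 0<δ →
      let c , 0<c , N₁ , far = away-from-zero x≉0
          N₂ , close = xy≈0 (c ℚ.* δ) (0<p*q 0<c 0<δ)
      in N₁ ℕ.⊔ N₂ , λ {n} N≤n → ℚ.≰⇒> λ δ≤∣yₙ∣ → ℚ.<-irrefl ≡.refl (ℚ.≤-<-trans
        (*-mono-≤ 0<c 0<δ (far (ℕ.m⊔n≤o⇒m≤o N₁ N₂ N≤n)) δ≤∣yₙ∣)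
        (≡.subst (ℚ._< c ℚ.* δ) (∣p*q-0∣≡∣p∣*∣q-0∣ (seq x n) (seq y n))
          (close (ℕ.m⊔n≤o⇒n≤o N₁ N₂ N≤n))))) ⟧
      where
      open ℚ.≤-Reasoning
      0<p*q : ∀ {p q} → 0ℚ ℚ.< p → 0ℚ ℚ.< q → 0ℚ ℚ.< p ℚ.* q
      0<p*q {p} {q} 0<p 0<q = ≡.subst (ℚ._< p ℚ.* q) (ℚ.*-zeroʳ p) (ℚ.*-monoʳ-<-pos p {{ℚ.positive 0<p}} 0<q)
      ∣p*q-0∣≡∣p∣*∣q-0∣ : ∀ p q → ℚ.∣ p ℚ.* q ℚ.- 0ℚ ∣ ≡ ℚ.∣ p ∣ ℚ.* ℚ.∣ q ℚ.- 0ℚ ∣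
      ∣p*q-0∣≡∣p∣*∣q-0∣ p q = ≡.trans
        (≡.cong ℚ.∣_∣ (≡.trans (ℚ.+-identityʳ (p ℚ.* q)) (≡.cong (p ℚ.*_) (≡.sym (ℚ.+-identityʳ q)))))
        (ℚ.∣p*q∣≡∣p∣*∣q∣ p (q ℚ.- 0ℚ))
      *-mono-≤ : ∀ {c p δ r} → 0ℚ ℚ.< c → 0ℚ ℚ.< δ → c ℚ.≤ p → δ ℚ.≤ r → c ℚ.* δ ℚ.≤ p ℚ.* r
      *-mono-≤ {c} {p} {δ} {r} 0<c 0<δ c≤p δ≤r = begin
        c ℚ.* δ   ≤⟨ ℚ.*-monoʳ-≤-nonNeg δ {{ℚ.pos⇒nonNeg δ {{ℚ.positive 0<δ}}}} c≤p ⟩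
        p ℚ.* δ   ≤⟨ ℚ.*-monoˡ-≤-nonNeg p {{ℚ.nonNegative (ℚ.≤-trans (ℚ.<⇒≤ 0<c) c≤p)}} δ≤r ⟩
        p ℚ.* r   ∎

  integral : ∀ {x y} → x ⊛ y ≋ 0ℝ → x ≋ 0ℝ ⊎ y ≋ 0ℝ
  integral {x} xy≋0 with x ≋? 0ℝ
  ... | yes x≋0 = inj₁ x≋0
  ... | no  x≉0 = inj₂ (zero-divisor xy≋0 x≉0)

-- Drawings with few slopes

coGraph : ∀ {n} → List (Edge n) → Graph n
coGraph S = record
  { Adj    = λ i j → i ≢ j × ¬ (i , j) ∈ S × ¬ (j , i) ∈ S
  ; symm   = λ (i≢j , ij∉ , ji∉) → ≡.≢-sym i≢j , ji∉ , ij∉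
  ; irrefl = λ i≡j (i≢j , _) → i≢j i≡j
  }

open FunctionSpace ℝ-commutativeRing
open CommutativeRing ℝ-commutativeRing
  using (+-group; +-cong; *-cong; *-congˡ; zeroʳ; zeroˡ; -‿inverseʳ; refl; sym; trans)

toLine : Slope → Line
toLine (finite a) = slanted a
toLine ∞          = vertical

≋⇒⊕⊖≋0 : ∀ {x y} → x ≋ y → x ⊕ ⊖ y ≋ 0ℝ
≋⇒⊕⊖≋0 {x} {y} x≋y = trans (+-cong x≋y refl) (-‿inverseʳ y)

⊕⊖≋0⇒≋ : ∀ {x y} → x ⊕ ⊖ y ≋ 0ℝ → x ≋ y
⊕⊖≋0⇒≋ = Algebra.Properties.Group.x∙y⁻¹≈ε⇒x≈y +-group _ _

opaque
  unfolding _⊕_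

  ⊕⊖-≈ : ∀ {x y x′ y′ a} → y′ ⊕ ⊖ y ≋ a ⊛ (x′ ⊕ ⊖ x) → (y′ - y) ≈ a * (x′ - x)
  ⊕⊖-≈ ⟦ e ⟧ δ 0<δ = e δ 0<δ

  ≈-⊕⊖ : ∀ {x y x′ y′ a} → (y′ - y) ≈ a * (x′ - x) → y′ ⊕ ⊖ y ≋ a ⊛ (x′ ⊕ ⊖ x)
  ≈-⊕⊖ e = ⟦ (λ δ 0<δ → e δ 0<δ) ⟧

-- For a finite slope, equal first coordinates would make the rise zero as well and the points
-- equal; hence the line is not vertical.
factor-zero⇒slope : ∀ {v w} s → ¬ v ≈ₚ w → factor (toLine s) v w ≋ 0ℝ → LineHasSlope v w s
factor-zero⇒slope {x , y} {x′ , y′} (finite a) v≉w e =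
  (λ x≈x′ → v≉w (x≈x′ , _≋_.unwrap (sym (⊕⊖≋0⇒≋ {y′} {y} (trans dy≋adx
    (trans (*-congˡ {a} (≋⇒⊕⊖≋0 (sym ⟦ x≈x′ ⟧))) (zeroʳ a))))))) ,
  ⊕⊖-≈ {x} {y} {x′} {y′} {a} dy≋adx
  where
  dy≋adx : y′ ⊕ ⊖ y ≋ a ⊛ (x′ ⊕ ⊖ x)
  dy≋adx = ⊕⊖≋0⇒≋ e
factor-zero⇒slope ∞ v≉w e = _≋_.unwrap (sym (⊕⊖≋0⇒≋ e))

slope⇒factor-zero : ∀ {v w} s → LineHasSlope v w s → factor (toLine s) v w ≋ 0ℝ
slope⇒factor-zero {x , y} {x′ , y′} (finite a) (_ , e) = ≋⇒⊕⊖≋0 (≈-⊕⊖ {x} {y} {x′} {y′} {a} e)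
slope⇒factor-zero ∞ x≈x′ = ≋⇒⊕⊖≋0 (sym ⟦ x≈x′ ⟧)

1≉0 : ¬ fromℚ 1ℚ ≋ 0ℝ
1≉0 1≋0 with fromℚ-injective 1≋0
... | ()

withSlopes : ∀ {n j K} → (Fin j → Slope) → j ℕ.≤ K → Points n → Config n K
withSlopes {K = zero}  sl z≤n      P = P
withSlopes {K = suc K} sl z≤n      P = absent , withSlopes {K = K} sl z≤n P
withSlopes             sl (s≤s le) P = toLine (sl zero) , withSlopes (λ s → sl (suc s)) le P

base-withSlopes : ∀ {n j K} (sl : Fin j → Slope) (le : j ℕ.≤ K) (P : Points n) →
  base K (withSlopes sl le P) ≡ P
base-withSlopes {K = zero}  sl z≤n      P = ≡.refl
base-withSlopes {K = suc K} sl z≤n      P = base-withSlopes {K = K} sl z≤n P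
base-withSlopes             sl (s≤s le) P = base-withSlopes (λ s → sl (suc s)) le P

slope-zero⇒edgePoly-zero : ∀ {n j K} (sl : Fin j → Slope) (le : j ℕ.≤ K) (P : Points n) e s →
  let z = withSlopes sl le P in
  factor (toLine (sl s)) (lookup n (base K z) (proj₁ e)) (lookup n (base K z) (proj₂ e)) ≋ 0ℝ →
  edgePoly K e z ≋ 0ℝ
slope-zero⇒edgePoly-zero sl (s≤s le) P e zero    f≋0 = trans (*-cong f≋0 refl) (zeroˡ _)
slope-zero⇒edgePoly-zero sl (s≤s le) P e (suc s) f≋0 = trans
  (*-congˡ (slope-zero⇒edgePoly-zero (λ s → sl (suc s)) le P e s f≋0)) (zeroʳ _)

module Configurations (em : ExcludedMiddle 0ℓ) where
  open Classical em
  open ZeroPatterns _≋?_ 1≉0 integral public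

  edgePoly-zero⇒slope-zero : ∀ {n j K} (sl : Fin j → Slope) (le : j ℕ.≤ K) (P : Points n) e →
    let z = withSlopes sl le P in edgePoly K e z ≋ 0ℝ →
    ∃[ s ] factor (toLine (sl s)) (lookup n (base K z) (proj₁ e)) (lookup n (base K z) (proj₂ e)) ≋ 0ℝ
  edgePoly-zero⇒slope-zero {K = zero}  sl z≤n P e z≋0 = contradiction z≋0 1≉0
  edgePoly-zero⇒slope-zero {K = suc K} sl z≤n P e z≋0 with integral z≋0
  ... | inj₁ 1≋0  = contradiction 1≋0 1≉0
  ... | inj₂ z≋0′ = edgePoly-zero⇒slope-zero {K = K} sl z≤n P e z≋0′
  edgePoly-zero⇒slope-zero sl (s≤s le) P e z≋0 with integral z≋0
  ... | inj₁ f≋0  = zero , f≋0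
  ... | inj₂ z≋0′ = let s , f≋0 = edgePoly-zero⇒slope-zero (λ s → sl (suc s)) le P e z≋0′ in suc s , f≋0

  -- The drawn points are relabelled along the isomorphism. For a pair in `S`, a vanishing factor
  -- would give two distinct points a slope of the set and make them adjacent; for a pair outside
  -- `S`, adjacency supplies a slope whose factor vanishes.
  representable⇒realised : ∀ {n j K S} → j ℕ.≤ K → S ∈ subsets (edges n) →
    Representable (coGraph S) j → Realised (edgePoly K) (edges n) S
  representable⇒realised {n} {j} {K} {S} j≤K S∈ (m , P , Sl , iso) = u , nonzero , iszero
    where
    open _≅_ iso renaming (bijection to π)
    pt : Fin n → Point
    pt i = point P (π ⟨$⟩ʳ i)
    pts : Points n
    pts = tabulate n pt tt
    u : Config n K
    u = withSlopes (slope Sl) j≤K pts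
    at-u : ∀ i → lookup n (base K u) i ≡ pt i
    at-u i = ≡.trans (≡.cong (λ p → lookup n p i) (base-withSlopes (slope Sl) j≤K pts))
      (lookup-tabulate n pt tt i)
    π-injective : ∀ {i j} → π ⟨$⟩ʳ i ≡ π ⟨$⟩ʳ j → i ≡ j
    π-injective = Injection.injective (↔⇒↣ π)
    nonzero : ∀ {e} → e ∈ S → ¬ edgePoly K e u ≋ 0ℝ
    nonzero {e@(a , b)} e∈S e≋0 =
      let s , f≋0 = edgePoly-zero⇒slope-zero (slope Sl) j≤K pts e e≋0
          a≢b = Fin.<⇒≢ (edges-< n (subsets-⊆ (edges n) S∈ e∈S))
          f≋0′ = ≡.subst₂ (λ v w → factor (toLine (slope Sl s)) v w ≋ 0ℝ) (at-u a) (at-u b) f≋0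
          πa≢πb = λ πa≡πb → a≢b (π-injective πa≡πb)
          (_ , ab∉S , _) = Equivalence.from (preserves a b)
            (πa≢πb , s , factor-zero⇒slope (slope Sl s) (λ pa≈pb → πa≢πb (PointSet.distinct P pa≈pb)) f≋0′)
      in ab∉S e∈S
    iszero : ∀ {e} → e ∈ edges n → ¬ e ∈ S → edgePoly K e u ≋ 0ℝ
    iszero {e@(a , b)} e∈ e∉S =
      let a<b = edges-< n e∈
          (_ , s , h) = Equivalence.to (preserves a b)
            (Fin.<⇒≢ a<b , e∉S , λ ba∈S → Fin.<-asym a<b (edges-< n (subsets-⊆ (edges n) S∈ ba∈S)))
      in slope-zero⇒edgePoly-zero (slope Sl) j≤K pts e s
        (≡.subst₂ (λ v w → factor (toLine (slope Sl s)) v w ≋ 0ℝ) (≡.sym (at-u a)) (≡.sym (at-u b))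
          (slope⇒factor-zero (slope Sl s) h))

  -- If every `coGraph S` had a drawing with at most `K` slopes, all zero patterns would be
  -- realised, against `zeroPatterns-bound`. The graph is obtained by double negation, without being
  -- exhibited.
  some-unrepresentable : ∀ {n} K → let m = length (edges n) in
    (3 ℕ.+ m) ℕ.^ K ℕ.* (suc (m ℕ.* K) ℕ.* suc (m ℕ.* K)) ℕ.^ n ℕ.< 2 ℕ.^ m →
    ∃[ S ] S ∈ subsets (edges n) × ∀ j → Representable (coGraph S) j → K ℕ.< j
  some-unrepresentable {n} K small = dne λ none → ℕ.<⇒≱ small
    (zeroPatterns-bound K (edges-unique n) λ {S} S∈ → dne λ unrealised →
      none (S , S∈ , λ j rep → ℕ.≰⇒> λ j≤K → unrealised (representable⇒realised j≤K S∈ rep)))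

-- Existence of a drawing

lookup-injective : ∀ {A : Set} {xs : List A} → Unique xs → ∀ {i j} → List.lookup xs i ≡ List.lookup xs j → i ≡ j
lookup-injective (x∉ ∷ xs!) {zero}  {zero}  e = ≡.refl
lookup-injective (x∉ ∷ xs!) {zero}  {suc j} e = contradiction e (All.lookup x∉ (∈-lookup j))
lookup-injective (x∉ ∷ xs!) {suc i} {zero}  e = contradiction (≡.sym e) (All.lookup x∉ (∈-lookup i))
lookup-injective (x∉ ∷ xs!) {suc i} {suc j} e = ≡.cong suc (lookup-injective xs! e)

≅-identity : ∀ {n} {G H : Graph n} → (∀ i j → Adj G i j ⇔ Adj H i j) → G ≅ H
≅-identity same = record { bijection = Permutation.id ; preserves = same }

-- The points (2ⁱ , 4ⁱ) lie on a parabola, so the slope between the i-th and the j-th is 2ⁱ + 2ʲ, and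
-- distinct pairs have distinct slopes.
module GeneralPosition (n : ℕ) where

  parabola : Fin n → Point
  parabola i = fromℕ (2 ℕ.^ toℕ i) , fromℕ (2 ℕ.^ toℕ i ℕ.* 2 ℕ.^ toℕ i)

  x-injective : ∀ {i j : Fin n} → fromℕ (2 ℕ.^ toℕ i) ≈ fromℕ (2 ℕ.^ toℕ j) → i ≡ j
  x-injective e = Fin.toℕ-injective (2^-injective (ι-injective (fromℚ-injective ⟦ e ⟧)))

  points : PointSet n
  points = record { point = parabola ; distinct = λ (x≈x′ , _) → x-injective x≈x′ }

  edgeSlope : Edge n → ℕ
  edgeSlope (i , j) = 2 ℕ.^ toℕ i ℕ.+ 2 ℕ.^ toℕ j

  square-slope : ∀ s t → t ℚ.* t ℚ.- s ℚ.* s ≡ (s ℚ.+ t) ℚ.* (t ℚ.- s)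
  square-slope = solve 2 (λ s t → t :* t :- s :* s := (s :+ t) :* (t :- s)) ≡.refl
    where open ℚ.+-*-Solver using (solve; _:=_; _:+_; _:*_; _:-_)

  rise : ∀ (v w : Fin n) → ι (2 ℕ.^ toℕ w ℕ.* 2 ℕ.^ toℕ w) ℚ.- ι (2 ℕ.^ toℕ v ℕ.* 2 ℕ.^ toℕ v)
    ≡ ι (edgeSlope (v , w)) ℚ.* (ι (2 ℕ.^ toℕ w) ℚ.- ι (2 ℕ.^ toℕ v))
  rise v w = ≡.trans
    (≡.cong₂ ℚ._-_ (ι-* (2 ℕ.^ toℕ w) (2 ℕ.^ toℕ w)) (ι-* (2 ℕ.^ toℕ v) (2 ℕ.^ toℕ v)))
    (≡.trans (square-slope (ι (2 ℕ.^ toℕ v)) (ι (2 ℕ.^ toℕ w)))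
      (≡.cong (ℚ._* (ι (2 ℕ.^ toℕ w) ℚ.- ι (2 ℕ.^ toℕ v))) (≡.sym (ι-+ (2 ℕ.^ toℕ v) (2 ℕ.^ toℕ w)))))

  has-edgeSlope : ∀ {v w} → v ≢ w → LineHasSlope (point points v) (point points w) (finite (fromℕ (edgeSlope (v , w))))
  has-edgeSlope {v} {w} v≢w = (λ x≈x′ → v≢w (x-injective x≈x′)) ,
    λ δ 0<δ → 0 , λ _ → ≡.subst (ℚ._< δ)
      (≡.sym (≡.cong ℚ.∣_∣ (≡.trans (≡.cong (ℚ._- q) (rise v w)) (ℚ.+-inverseʳ q)))) 0<δ
    where
    q : ℚ
    q = ι (edgeSlope (v , w)) ℚ.* (ι (2 ℕ.^ toℕ w) ℚ.- ι (2 ℕ.^ toℕ v))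

  edgeSlope-unique : ∀ {v w a} → LineHasSlope (point points v) (point points w) (finite (fromℕ a)) →
    a ≡ edgeSlope (v , w)
  edgeSlope-unique {v} {w} {a} (x≉x′ , e) = ι-injective (*-cancelʳ run≢0 (≡.trans
    (≡.sym (fromℚ-injective {rise′} {ι a ℚ.* run} ⟦ (λ δ 0<δ → e δ 0<δ) ⟧)) (rise v w)))
    where
    rise′ run : ℚ
    rise′ = ι (2 ℕ.^ toℕ w ℕ.* 2 ℕ.^ toℕ w) ℚ.- ι (2 ℕ.^ toℕ v ℕ.* 2 ℕ.^ toℕ v)
    run = ι (2 ℕ.^ toℕ w) ℚ.- ι (2 ℕ.^ toℕ v)
    run≢0 : run ≢ 0ℚ
    run≢0 run≡0 = x≉x′ λ δ 0<δ → 0 , λ _ → ≡.subst (ℚ._< δ)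
      (≡.trans (≡.cong ℚ.∣_∣ (≡.sym run≡0)) (∣p-q∣≡∣q-p∣ (ι (2 ℕ.^ toℕ w)) (ι (2 ℕ.^ toℕ v)))) 0<δ
      where
      open ℚ.+-*-Solver using (solve; _:=_; _:-_; :-_)
      ∣p-q∣≡∣q-p∣ : ∀ p q → ℚ.∣ p ℚ.- q ∣ ≡ ℚ.∣ q ℚ.- p ∣
      ∣p-q∣≡∣q-p∣ p q = ≡.trans (≡.sym (ℚ.∣-p∣≡∣p∣ (p ℚ.- q)))
        (≡.cong ℚ.∣_∣ (solve 2 (λ p q → :- (p :- q) := q :- p) ≡.refl p q))

  edgeSlope-injective : ∀ {e f} → e ∈ edges n → f ∈ edges n → edgeSlope e ≡ edgeSlope f → e ≡ f
  edgeSlope-injective e∈ f∈ eq with powers-of-2-sidon (edges-< n e∈) (edges-< n f∈) eq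
  ... | i≡k , j≡l = ≡.cong₂ _,_ (Fin.toℕ-injective i≡k) (Fin.toℕ-injective j≡l)

  module _ {S : List (Edge n)} (S∈ : S ∈ subsets (edges n)) where
    outside? : ∀ e → Dec (¬ e ∈ S)
    outside? e = ¬? (DecMembership._∈?_ (Product.≡-dec Fin._≟_ Fin._≟_) e S)

    nonmembers : List (Edge n)
    nonmembers = filter outside? (edges n)

    nonmember : ∀ s → List.lookup nonmembers s ∈ edges n × ¬ List.lookup nonmembers s ∈ S
    nonmember s = ∈-filter⁻ outside? (∈-lookup s)

    slopes : SlopeSet (length nonmembers)
    slopes = record
      { slope    = λ s → finite (fromℕ (edgeSlope (List.lookup nonmembers s)))
      ; distinct = λ { {s} {t} (finite a≈b) → lookup-injective
          (Unique.filter⁺ outside? (edges-unique n))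
          (edgeSlope-injective (proj₁ (nonmember s)) (proj₁ (nonmember t))
            (ι-injective {edgeSlope (List.lookup nonmembers s)} {edgeSlope (List.lookup nonmembers t)}
              (fromℚ-injective ⟦ a≈b ⟧))) }
      }

    reversed∉S : ∀ {v w} → (v , w) ∈ edges n → ¬ (w , v) ∈ S
    reversed∉S vw∈ wv∈S = Fin.<-asym (edges-< n vw∈) (edges-< n (subsets-⊆ (edges n) S∈ wv∈S))

    compare : ∀ {v w : Fin n} → v ≢ w → v Fin.< w ⊎ w Fin.< v
    compare {v} {w} v≢w with Fin.<-cmp v w
    ... | tri< v<w _ _ = inj₁ v<w
    ... | tri≈ _ v≡w _ = contradiction v≡w v≢w
    ... | tri> _ _ w<v = inj₂ w<v

    find-slope : ∀ {v w a} → v ≢ w → a ≡ edgeSlope (v , w) → ∀ {e} → e ∈ nonmembers → edgeSlope e ≡ a →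
      ∃[ s ] LineHasSlope (point points v) (point points w) (slope slopes s)
    find-slope {v} {w} v≢w ≡.refl e∈ eq = Any.index e∈ , ≡.subst
      (λ b → LineHasSlope (point points v) (point points w) (finite (fromℕ b)))
      (≡.trans (≡.sym eq) (≡.cong edgeSlope (Any.lookup-index e∈)))
      (has-edgeSlope v≢w)

    -- This makes the slope parameter exist. A pair is adjacent in the drawing only if its slope is
    -- that of a pair outside `S`, and by injectivity of `edgeSlope` this is the same pair up to
    -- order.
    coGraph-representable : Representable (coGraph S) (length nonmembers)
    coGraph-representable = n , points , slopes , ≅-identity λ v w → mk⇔
      (λ (v≢w , vw∉S , wv∉S) → v≢w , to v w v≢w vw∉S wv∉S)
      (λ (v≢w , s , h) → v≢w ,
        from v w v≢w s (edgeSlope-unique {v} {w} {edgeSlope (List.lookup nonmembers s)} h))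
      where
      to : ∀ v w → v ≢ w → ¬ (v , w) ∈ S → ¬ (w , v) ∈ S →
        ∃[ s ] LineHasSlope (point points v) (point points w) (slope slopes s)
      to v w v≢w vw∉S wv∉S = [ (λ v<w → find-slope v≢w ≡.refl
            (∈-filter⁺ outside? (edges-complete n v<w) vw∉S) ≡.refl)
        , (λ w<v → find-slope v≢w ≡.refl
            (∈-filter⁺ outside? (edges-complete n w<v) wv∉S) (ℕ.+-comm (2 ℕ.^ toℕ w) (2 ℕ.^ toℕ v)))
        ]′ (compare v≢w)
      from : ∀ v w → v ≢ w → ∀ s → edgeSlope (List.lookup nonmembers s) ≡ edgeSlope (v , w) →
        ¬ (v , w) ∈ S × ¬ (w , v) ∈ S
      from v w v≢w s eq with compare v≢w
      ... | inj₁ v<w = ≡.subst (λ e → ¬ e ∈ S)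
        (edgeSlope-injective (proj₁ (nonmember s)) (edges-complete n v<w) eq) (proj₂ (nonmember s)) ,
        reversed∉S (edges-complete n v<w)
      ... | inj₂ w<v = reversed∉S (edges-complete n w<v) , ≡.subst (λ e → ¬ e ∈ S)
        (edgeSlope-injective (proj₁ (nonmember s)) (edges-complete n w<v)
          (≡.trans eq (ℕ.+-comm (2 ℕ.^ toℕ v) (2 ℕ.^ toℕ w)))) (proj₂ (nonmember s))

-- Number of slopes and passage to logarithms

open Arithmetic
open Rational

module _ (em : ExcludedMiddle 0ℓ) where

  Least : (ℕ → Set) → ℕ → Set
  Least P k = P k × ∀ j → P j → k ℕ.≤ j

  least-below : ∀ (P : ℕ → Set) K → (∃[ k ] Least P k) ⊎ (∀ j → P j → K ℕ.≤ j)
  least-below P zero    = inj₂ λ _ _ → z≤n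
  least-below P (suc K) with least-below P K
  ... | inj₁ found = inj₁ found
  ... | inj₂ none with em {P K}
  ...   | yes PK = inj₁ (K , PK , none)
  ...   | no ¬PK = inj₂ λ j Pj → ℕ.≤∧≢⇒< (none j Pj) λ { ≡.refl → ¬PK Pj }

  least : ∀ {P : ℕ → Set} {K} → P K → ∃[ k ] Least P k
  least {P} {K} PK with least-below P (suc K)
  ... | inj₁ found = found
  ... | inj₂ none  = contradiction (none K PK) (ℕ.<-irrefl ≡.refl)

n<2^[1+⌊log₂n⌋] : ∀ n → n ℕ.< 2 ℕ.^ suc ⌊log₂ n ⌋
n<2^[1+⌊log₂n⌋] n = ℕ.≰⇒> λ h → ℕ.<-irrefl ≡.refl
  (≡.subst (ℕ._≤ ⌊log₂ n ⌋) (⌊log₂[2^n]⌋≡n (suc ⌊log₂ n ⌋)) (⌊log₂⌋-mono-≤ h))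

-- This is x ≤ y log n, with log n replaced by its upper approximation (⌊log₂ n ^ ℓ⌋ + 1) / ℓ and
-- the denominator cleared.
log-bound : ∀ {x n y} ℓ → 2 ℕ.^ x ℕ.≤ n ℕ.^ y → x ℕ.* ℓ ℕ.≤ suc ⌊log₂ n ℕ.^ ℓ ⌋ ℕ.* y
log-bound {x} {n} {y} ℓ h = ℕ.s≤s⁻¹ (2^-cancel-< {x ℕ.* ℓ} {suc (suc ⌊log₂ n ℕ.^ ℓ ⌋ ℕ.* y)} (begin-strict
  2 ℕ.^ (x ℕ.* ℓ)                              ≡⟨ ℕ.^-*-assoc 2 x ℓ ⟨
  (2 ℕ.^ x) ℕ.^ ℓ                              ≤⟨ ℕ.^-monoˡ-≤ ℓ h ⟩
  (n ℕ.^ y) ℕ.^ ℓ                              ≡⟨ ℕ.^-*-assoc n y ℓ ⟩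
  n ℕ.^ (y ℕ.* ℓ)                              ≡⟨ ≡.cong (n ℕ.^_) (ℕ.*-comm y ℓ) ⟩
  n ℕ.^ (ℓ ℕ.* y)                              ≡⟨ ℕ.^-*-assoc n ℓ y ⟨
  (n ℕ.^ ℓ) ℕ.^ y                              ≤⟨ ℕ.^-monoˡ-≤ y (ℕ.<⇒≤ (n<2^[1+⌊log₂n⌋] (n ℕ.^ ℓ))) ⟩
  (2 ℕ.^ suc ⌊log₂ n ℕ.^ ℓ ⌋) ℕ.^ y            ≡⟨ ℕ.^-*-assoc 2 (suc ⌊log₂ n ℕ.^ ℓ ⌋) y ⟩
  2 ℕ.^ (suc ⌊log₂ n ℕ.^ ℓ ⌋ ℕ.* y)            <⟨ ℕ.^-monoʳ-< 2 (s≤s (s≤s z≤n)) (ℕ.n<1+n (suc ⌊log₂ n ℕ.^ ℓ ⌋ ℕ.* y)) ⟩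
  2 ℕ.^ suc (suc ⌊log₂ n ℕ.^ ℓ ⌋ ℕ.* y)        ∎))
  where open ℕ.≤-Reasoning

module _ (em : ExcludedMiddle 0ℓ) where
  open Configurations em

  module _ (q n : ℕ) (2≤n : 2 ℕ.≤ n) where

    -- The inequality n² ≤ (4 + 1 / q) k log n, multiplied by q and exponentiated, so that it speaks
    -- of natural numbers only.
    Enough : ℕ → Set
    Enough k = 2 ℕ.^ (q ℕ.* (n ℕ.* n)) ℕ.≤ n ℕ.^ (suc (4 ℕ.* q) ℕ.* k)

    enough-mono : ∀ {j} k → j ℕ.≤ k → Enough j → Enough k
    enough-mono k j≤k enough = ℕ.≤-trans enough
      (ℕ.^-monoʳ-≤ n {{ℕ.>-nonZero (ℕ.<⇒≤ 2≤n)}} (ℕ.*-monoʳ-≤ (suc (4 ℕ.* q)) j≤k))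

    eventually-enough : Enough (q ℕ.* (n ℕ.* n))
    eventually-enough = ℕ.≤-trans (ℕ.^-monoˡ-≤ (q ℕ.* (n ℕ.* n)) 2≤n)
      (ℕ.^-monoʳ-≤ n {{ℕ.>-nonZero (ℕ.<⇒≤ 2≤n)}} (ℕ.m≤m+n (q ℕ.* (n ℕ.* n)) _))

    -- If `suc K` is the least number that is enough, then `K` is not, which is the hypothesis of
    -- the dimension estimate. Some graph therefore needs more than `K` slopes, that is, at least
    -- `suc K`.
    lower-bound : n ℕ.^ (17 ℕ.* suc (4 ℕ.* q)) ℕ.≤ 2 ℕ.^ n →
      Σ (Graph n) λ G → ∃[ k ] IsSlopeParameter G k × Enough k
    lower-bound growth = found (least em {Enough} {q ℕ.* (n ℕ.* n)} eventually-enough)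
      where
      found : ∃[ K ] Least em Enough K → Σ (Graph n) λ G → ∃[ k ] IsSlopeParameter G k × Enough k
      -- This happens only for `q` zero; every graph then qualifies, and the complete graph is
      -- taken.
      found (zero , enough , _) =
        let k , isSlope = least em (GeneralPosition.coGraph-representable n ([]∈subsets (edges n)))
        in coGraph [] , k , isSlope , enough-mono {zero} k z≤n enough
      found (suc K , enough , minimal) =
        let S , S∈ , many = some-unrepresentable K (dimension<2^m {q} {n} {K} {length (edges n)} 2≤n (length-edges n) growth
              (ℕ.≰⇒> λ h → ℕ.<-irrefl ≡.refl (minimal K h)))
            k , isSlope = least em (GeneralPosition.coGraph-representable n S∈)
        in coGraph S , k , isSlope , enough-mono {suc K} k (many k (proj₁ isSlope)) enough

-- The order `≤` on reals is the negation of `<`, so a gap `δ′` is assumed and refuted at a single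
-- index `j`. At that index `δ ≤ ε`, hence 1 / q ≤ ε.
asymptotic : ∀ q n k {ε δ} → 1ℚ ℚ.≤ ι q ℚ.* δ → 1 ℕ.≤ q → ∃[ N ] (∀ {j} → N ℕ.≤ j → δ ℚ.≤ seq ε j) →
  2 ℕ.^ (q ℕ.* (n ℕ.* n)) ℕ.≤ n ℕ.^ (suc (4 ℕ.* q) ℕ.* k) →
  fromℕ n * fromℕ n ≤ fromℕ k * ((fromℕ 4 + ε) * log₂ n)
asymptotic q n k {ε} {δ} 1≤qδ 1≤q (N , δ≤ε) enough (δ′ , 0<δ′ , N′ , gap) =
  let q′ , 1≤q′δ′ = archimedean 0<δ′
      -- Beyond this index the rounding error of the logarithm, multiplied by `suc (4 * q) * k`, is
      -- smaller than `q` times the gap.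
      L = suc (suc (4 ℕ.* q) ℕ.* k) ℕ.* q′
      j = (N ℕ.⊔ N′) ℕ.⊔ L
  in no-gap {n} {k} {q} {q′} {⌊log₂ n ℕ.^ suc j ⌋} {suc j} {seq ε j} {seq (log₂ n) j} {δ} {δ′}
       (/-*-/1 ⌊log₂ n ℕ.^ suc j ⌋ j) 1≤qδ (δ≤ε (ℕ.≤-trans (ℕ.m≤m⊔n N N′) (ℕ.m≤m⊔n (N ℕ.⊔ N′) L)))
       1≤q (ℚ.<⇒≤ 0<δ′) 1≤q′δ′ (log-bound {q ℕ.* (n ℕ.* n)} {n} {suc (4 ℕ.* q) ℕ.* k} (suc j) enough) (ℕ.m≤n⇒m≤1+n (ℕ.m≤n⊔m (N ℕ.⊔ N′) L))
       (gap (ℕ.≤-trans (ℕ.m≤n⊔m N N′) (ℕ.m≤m⊔n (N ℕ.⊔ N′) L)))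

theorem4 : ExcludedMiddle 0ℓ →
    ∀ (ε : ℝ) → 0ℝ < ε →
    ∃[ n₀ ] ∀ (n : ℕ) → n₀ ℕ.< n →
    Σ (Graph n) λ G → ∃[ k ] IsSlopeParameter G k ×
    fromℕ n * fromℕ n ≤ fromℕ k * ((fromℕ 4 + ε) * log₂ n)
theorem4 em ε (δ , 0<δ , N , δ≤ε) =
  let q , 1≤qδ = archimedean 0<δ
      -- Here 17 = 2 · 8 + 1: the coordinates contribute `n ^ (8 * n)`, which is raised to the power
      -- `2 * suc (4 * q)`, and the diagonal term `n` of n² = 2 m + n adds one more.
      c = 17 ℕ.* suc (4 ℕ.* q)
  in 2 ℕ.^ (4 ℕ.* c) , λ n n₀<n →
    let G , k , isSlope , enough = lower-bound em q n (ℕ.≤-<-trans (ℕ.m^n>0 2 (4 ℕ.* c)) n₀<n)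
          (n^c≤2^n c n (ℕ.<⇒≤ n₀<n))
    in G , k , isSlope , asymptotic q n k {ε} 1≤qδ (positive 1≤qδ)
         (N , λ {j} N≤j → ≡.subst (ℚ._≤ seq ε j) (ℚ.+-identityˡ δ) (δ≤ε N≤j)) enough
  where
  positive : ∀ {q} → 1ℚ ℚ.≤ ι q ℚ.* δ → 1 ℕ.≤ q
  positive {zero} h = contradiction (≡.subst (1ℚ ℚ.≤_) (ℚ.*-zeroˡ δ) h) λ { (ℚ.*≤* (ℤ.+≤+ ())) }
  positive {suc q} _ = s≤s z≤n
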